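{- Let $k\geq 4$ and $\ell\geq 3$ be integers, $t=\lfloor\frac{\ell-1}{2}\rfloor$, $s=k\ell$. For every function $g(n)=o(n^{k-1})$ there exist a function $h(n)=o(n)$ and an integer $n_1$ such that for all $n\geq n_1$ the following holds: if $\mathcal{F}$ is a family of $k$-subsets of $[n]$ that is centralized with threshold $s$, does not contain $\mathbb{C}^{(k)}_\ell$, and satisfies $|\mathcal{F}|\geq t\binom{n}{k-1}-g(n)$, then there exist disjoint sets $S,T\subseteq[n]$ with $|S|=t$ and $|T|\geq n-h(n)$ such that $\{a,x\}\in\mathrm{Ker}^{(2)}_s(\mathcal{F})$ for every $a\in S$ and $x\in T$.
   Context: Kernel degree: $\deg^*_{\mathcal{F}}(D)$ is the largest $s$ such that $\mathcal{F}$ contains $s$ members pairwise intersecting exactly in $D$ and each strictly containing $D$; $\mathrm{Ker}_s(\mathcal{F})=\{D:\deg^*_{\mathcal{F}}(D)\geq s\}$ and $\mathrm{Ker}^{(2)}_s(\mathcal{F})$ is the set of its $2$-element members. $\mathcal{F}$ is centralized with threshold $s$ if for every $F\in\mathcal{F}$ there is $c(F)\in F$ such that every proper subset of $F$ containing $c(F)$ lies in $\mathrm{Ker}_s(\mathcal{F})$. $\mathbb{C}^{(k)}_\ell$: $k$-sets $F_1,\dots,F_\ell$ and distinct vertices $v_1,\dots,v_\ell$ with $F_i\cap\{v_1,\dots,v_\ell\}=\{v_i,v_{i+1}\}$ (indices mod $\ell$) and the $F_i\setminus\{v_1,\dots,v_\ell\}$ pairwise disjoint. -}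

module Defs where

open import Data.Nat using (ℕ; zero; suc; _+_; _*_; _≤_)
open import Data.Nat.DivMod using (_%_; m%n<n)
open import Data.Fin using (Fin; toℕ; fromℕ<)
open import Data.Fin.Subset using (Subset; _∈_; _⊂_; _∩_)
open import Data.List using (List)
import Data.List.Membership.Propositional as LM
open import Data.Product using (Σ; ∃; _×_)
open import Data.Sum using (_⊎_)
open import Relation.Binary.PropositionalEquality using (_≡_; _≢_)
open import Relation.Nullary using (¬_)

LittleO : (ℕ → ℕ) → (ℕ → ℕ) → Set
LittleO f g = ∀ (m : ℕ) → ∃ λ (N : ℕ) → ∀ (n : ℕ) → N ≤ n → m * f n ≤ g n

-- A family of subsets of [n] is a duplicate-free list of subsets.
Family : ℕ → Set
Family n = List (Subset n)

InKer : ∀ {n} → ℕ → Family n → Subset n → Set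
InKer {n} s 𝓕 D =
  Σ (Fin s → Subset n) λ F →
    (∀ i → F i LM.∈ 𝓕) ×
    (∀ i → D ⊂ F i) ×
    (∀ i j → i ≢ j → F i ∩ F j ≡ D)

Centralized : ∀ {n} → ℕ → Family n → Set
Centralized {n} s 𝓕 =
  ∀ (F : Subset n) → F LM.∈ 𝓕 →
    ∃ λ (c : Fin n) → c ∈ F ×
      (∀ (A : Subset n) → A ⊂ F → c ∈ A → InKer s 𝓕 A)

cycSuc : ∀ {m} → Fin (suc m) → Fin (suc m)
cycSuc {m} i = fromℕ< (m%n<n (suc (toℕ i)) (suc m))

-- 𝓕 contains a copy of the k-uniform ℓ-cycle ℂ^(k)_ℓ (ℓ = suc m);
-- members of 𝓕 are k-sets, so each F i is automatically a k-set.
ContainsCycle : ∀ {n} → ℕ → Family n → Set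
ContainsCycle {n} m 𝓕 =
  Σ (Fin (suc m) → Subset n) λ F →
  Σ (Fin (suc m) → Fin n) λ v →
    (∀ i → F i LM.∈ 𝓕) ×
    (∀ i j → v i ≡ v j → i ≡ j) ×
    (∀ i j → (v j ∈ F i → (j ≡ i ⊎ j ≡ cycSuc i))
           × ((j ≡ i ⊎ j ≡ cycSuc i) → v j ∈ F i)) ×
    (∀ i j (x : Fin n) → (∀ r → v r ≢ x) → x ∈ F i → x ∈ F j → i ≡ j)

{-# OPTIONS --safe #-}

-- Kernel sets arranged as a cycle can be replaced one at a time by petals avoiding everything chosen so
-- far, so it suffices to find cycles of kernel sets. Write a ⟶ x if some member with center a contains
-- x ≠ a, and R a x y if such a member contains both x and y. An alternating closed walk z₀ a₀ z₁ a₁ … z_t a_t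
-- with aᵢ ⟶ zᵢ and aᵢ ⟶ zᵢ₊₁ consists of 2t + 2 kernel pairs; if R a₀ z₀ z₁ holds, then the kernel triple
-- {z₀, a₀, z₁} turns it into a cycle of length 2t + 1.
--
-- If the bipartite graph {(a, y) : R a w y} had more than a constant times n edges, it would contain a
-- long path, which closes up through w. Hence the weights #{(w, y) : R a w y} add up to O(n²), only
-- boundedly many vertices a (the hubs) have weight at least n²/d², and the other centers account for only
-- O(n^(k-1) / d) of the ordered (k-1)-tuples that list a member without its center.
--
-- For all but boundedly many x, any t + 1 hubs pointing to x have many common out-neighbours; then R a x y
-- for a hub a forces at most t hubs to point to both x and y, since t + 1 of them would give an
-- alternating closed walk. So a typical tuple arises from at most t hubs, and by the density of 𝓕 almost all
-- tuples arise from exactly t. Fix all entries of the tuple but one, among them x and y, so that this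
-- holds for almost all values z of the remaining entry: the t hubs pointing to x and y form S, and all of
-- them point to each such z.
module Submission where

open import Defs
open import Data.Bool using (true; if_then_else_)
open import Data.Empty using (⊥)
open import Data.Fin using (Fin; zero; suc; fromℕ; fromℕ<; inject₁)
open import Data.Fin.Properties using (_≟_; suc-injective; any?; all?; toℕ-injective; toℕ-fromℕ<; toℕ-fromℕ; toℕ-inject₁; toℕ<n)
open import Data.Fin.Relation.Unary.Top using (view; ‵fromℕ; ‵inject₁)
open import Data.Fin.Subset using (Subset; ∣_∣; _∈_; _∉_; _⊆_; _⊂_; ⁅_⁆; _∪_; inside; outside)
open import Data.Fin.Subset.Properties using (_∈?_; drop-there; p⊆q⇒∣p∣≤∣q∣; x∈p∩q⁺; x∈p∪q⁺; x∈p∪q⁻; x∈⁅x⁆; x∈⁅y⁆⇒x≡y; ∪-comm; ⊆-antisym)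
open import Data.List as List using (List; []; _∷_; length; allFin)
open import Data.List.Membership.Propositional renaming (_∈_ to _∈ˡ_) using ()
open import Data.List.Membership.Propositional.Properties using (∈-lookup; ∈-allFin)
open import Data.List.Relation.Unary.All using (All)
import Data.List.Relation.Unary.All as ListAll
open import Data.List.Relation.Unary.AllPairs renaming (_∷_ to _∷ᵃ_) using ()
open import Data.List.Relation.Unary.Any using (here; there)
open import Data.List.Relation.Unary.Unique.Propositional using (Unique)
open import Data.Nat using (ℕ; zero; suc; _+_; _*_; _∸_; _^_; _≤_; _<_; _/_; _%_; _!; _⊔_; _≤?_; _<?_; z≤n; s≤s; z<s; s≤s⁻¹; NonZero; >-nonZero) renaming (_≟_ to _≟ℕ_)
open import Data.Nat.Combinatorics using (_C_; nCk≡nPk/k!; nPk≡n!/[n∸k]!) renaming (_P_ to _Perm_)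
open import Data.Nat.Combinatorics.Base using (_P′_)
open import Data.Nat.Combinatorics.Specification using (k!∣nP′k; nP′k≡n!/[n∸k]!)
open import Data.Nat.DivMod using (m%n<n; m<n⇒m%n≡m; n%n≡0; m≡m%n+[m/n]*n; m*n/n≡m; m*[n/m]≡n; m/n*n≤m; /-monoˡ-≤; m≥n⇒m/n>0)
open import Data.Nat.Properties hiding (_≟_; suc-injective)
import Algebra.Properties.Semiring.Sum +-*-semiring as Sum
open import Data.Nat.Tactic.RingSolver using (solve-∀)
open import Data.Product using (Σ; ∃; _×_; _,_; proj₁; proj₂)
open import Data.Sum using (_⊎_; inj₁; inj₂; [_,_]′) renaming (map to ⊎-map; map₂ to ⊎-map₂)
open import Data.Unit using (⊤; tt)
open import Data.Vec using (Vec; []; _∷_; here; there; lookup; tabulate; last; head)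
open import Data.Vec.Properties using (lookup⇒[]=; []=⇒lookup; lookup∘tabulate)
open import Data.Vec.Relation.Unary.All as All using ([]; _∷_) renaming (All to Allᵛ)
open import Data.Vec.Relation.Unary.All.Properties as AllP using ()
open import Data.Vec.Relation.Unary.AllPairs using (allPairs?)
open import Data.Vec.Relation.Unary.Linked using (Linked; []; [-]; _∷_)
open import Data.Vec.Relation.Unary.Unique.Propositional using ([]; _∷_) renaming (Unique to Uniqueᵛ)
open import Data.Vec.Relation.Unary.Unique.Propositional.Properties using (lookup-injective)
open import Function using (_∘_; id)
open import Relation.Binary.PropositionalEquality using (_≡_; _≢_; refl; sym; trans; cong; cong₂; subst; ≢-sym)
open import Relation.Nullary using (¬_; Dec; yes; no; does; ¬?; contradiction)
open import Relation.Nullary.Decidable using (_×-dec_; _→-dec_; map′; decidable-stable)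
open import Relation.Unary using (Decidable)

-- Finite sums, indicators and counting.

private
  variable
    n l m : ℕ
    P Q : Set

-- Opaque, so that summands are inferred by unification.
opaque
  ∑ : (Fin n → ℕ) → ℕ
  ∑ = Sum.sum

opaque
  unfolding ∑

  ∑-mono : {f g : Fin n → ℕ} → (∀ i → f i ≤ g i) → ∑ f ≤ ∑ g
  ∑-mono {zero} h = z≤n
  ∑-mono {suc n} h = +-mono-≤ (h zero) (∑-mono (h ∘ suc))

  ∑-const : ∀ n c → ∑ {n} (λ _ → c) ≡ n * c
  ∑-const zero c = refl
  ∑-const (suc n) c = cong (c +_) (∑-const n c)

  ∑-cong : {f g : Fin n → ℕ} → (∀ i → f i ≡ g i) → ∑ f ≡ ∑ g
  ∑-cong = Sum.sum-cong-≗

  ∑-comm : ∀ {m n} (f : Fin m → Fin n → ℕ) → ∑ (λ i → ∑ (f i)) ≡ ∑ (λ j → ∑ λ i → f i j)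
  ∑-comm = Sum.∑-comm

  ∑-distrib-+ : (f g : Fin n → ℕ) → ∑ (λ i → f i + g i) ≡ ∑ f + ∑ g
  ∑-distrib-+ = Sum.∑-distrib-+

  *-∑ : ∀ c (f : Fin n → ℕ) → c * ∑ f ≡ ∑ (λ i → c * f i)
  *-∑ = Sum.*-distribˡ-sum

  ∑-suc : (f : Fin (suc n) → ℕ) → ∑ f ≡ f zero + ∑ (f ∘ suc)
  ∑-suc f = refl

  ∑-zero : (f : Fin 0 → ℕ) → ∑ f ≡ 0
  ∑-zero f = refl

  term≤∑ : (f : Fin n → ℕ) (i : Fin n) → f i ≤ ∑ f
  term≤∑ f zero = m≤m+n _ _
  term≤∑ f (suc i) = m≤n⇒m≤o+n (f zero) (term≤∑ (f ∘ suc) i)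

  ∑-witness : (f : Fin n → ℕ) → 0 < ∑ f → ∃ λ i → 0 < f i
  ∑-witness {suc n} f h with f zero in eq
  ... | suc _ = zero , subst (0 <_) (sym eq) z<s
  ... | zero with ∑-witness (f ∘ suc) h
  ...   | i , p = suc i , p

∑-bound : {f : Fin n → ℕ} {c : ℕ} → (∀ i → f i ≤ c) → ∑ f ≤ n * c
∑-bound {n} {_} {c} h = ≤-trans (∑-mono h) (≤-reflexive (∑-const n c))

opaque
  ⟦_⟧ : Dec P → ℕ
  ⟦ p ⟧ = if does p then 1 else 0

opaque
  unfolding ⟦_⟧

  ⟦⟧≤1 : (p : Dec P) → ⟦ p ⟧ ≤ 1
  ⟦⟧≤1 (yes _) = ≤-refl
  ⟦⟧≤1 (no _) = z≤n

  ⟦⟧-yes : (p : Dec P) → P → ⟦ p ⟧ ≡ 1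
  ⟦⟧-yes (yes _) x = refl
  ⟦⟧-yes (no ¬x) x = contradiction x ¬x

  ⟦⟧-no : (p : Dec P) → ¬ P → ⟦ p ⟧ ≡ 0
  ⟦⟧-no (yes x) ¬x = contradiction x ¬x
  ⟦⟧-no (no _) ¬x = refl

  ⟦⟧-holds : (p : Dec P) → 0 < ⟦ p ⟧ → P
  ⟦⟧-holds (yes x) _ = x

  ⟦⟧-fails : (p : Dec P) → ⟦ p ⟧ ≡ 0 → ¬ P
  ⟦⟧-fails (no ¬x) _ = ¬x

  ⟦⟧-≤ : (p : Dec P) {c : ℕ} → (P → 1 ≤ c) → ⟦ p ⟧ ≤ c
  ⟦⟧-≤ (yes x) h = h x
  ⟦⟧-≤ (no _) h = z≤n

  ⟦⟧*-≤ : (p : Dec P) {b c : ℕ} → (P → b ≤ c) → ⟦ p ⟧ * b ≤ c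
  ⟦⟧*-≤ (yes x) {b} h = ≤-trans (≤-reflexive (*-identityˡ b)) (h x)
  ⟦⟧*-≤ (no _) h = z≤n

⟦⟧-mono : (p : Dec P) (q : Dec Q) → (P → Q) → ⟦ p ⟧ ≤ ⟦ q ⟧
⟦⟧-mono p q h = ⟦⟧-≤ p (λ x → ≤-reflexive (sym (⟦⟧-yes q (h x))))

# : {P : Fin n → Set} → Decidable P → ℕ
# P? = ∑ λ i → ⟦ P? i ⟧

#-mono : {P Q : Fin n → Set} (P? : Decidable P) (Q? : Decidable Q) → (∀ i → P i → Q i) → # P? ≤ # Q?
#-mono P? Q? h = ∑-mono λ i → ⟦⟧-mono (P? i) (Q? i) (h i)

opaque
  unfolding ∑ ⟦_⟧

  #≤1 : {P : Fin n → Set} (P? : Decidable P) → (∀ i j → P i → P j → i ≡ j) → # P? ≤ 1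
  #≤1 {zero} P? h = z≤n
  #≤1 {suc n} P? h with P? zero
  ... | no _ = #≤1 (P? ∘ suc) λ i j p q → suc-injective (h (suc i) (suc j) p q)
  ... | yes p = s≤s (≤-trans (∑-bound λ i → ≤-reflexive (⟦⟧-no (P? (suc i)) λ q → contradiction (h zero (suc i) p q) λ ())) (≤-reflexive (*-zeroʳ n)))

-- When `P i` says that a fixed point lies in the `i`-th of some disjoint sets, summing over the
-- points bounds the total size of these sets by that of any set containing them.
#≤⟦⟧ : {P : Fin n → Set} (P? : Decidable P) (q : Dec Q) → (∀ i → P i → Q) →
  (Q → ∀ i j → P i → P j → i ≡ j) → # P? ≤ ⟦ q ⟧
#≤⟦⟧ {n} P? (yes q) _ h = ≤-trans (#≤1 P? (h q)) (≤-reflexive (sym (⟦⟧-yes (yes q) q)))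
#≤⟦⟧ {n} P? (no ¬q) f _ = ≤-trans (∑-bound λ i → ≤-reflexive (⟦⟧-no (P? i) (¬q ∘ f i))) (≤-trans (≤-reflexive (*-zeroʳ n)) z≤n)

#≡ : ∀ (y : Fin n) → # (_≟ y) ≤ 1
#≡ y = #≤1 (_≟ y) λ i j p q → trans p (sym q)

#-delete : {P : Fin n → Set} (P? : Decidable P) (y : Fin n) →
  # P? ≤ suc (# λ x → P? x ×-dec ¬? (x ≟ y))
#-delete P? y = ≤-trans
  (∑-mono λ x → split x (x ≟ y))
  (≤-trans (≤-reflexive (∑-distrib-+ (λ x → ⟦ x ≟ y ⟧) _)) (+-monoˡ-≤ _ (#≡ y)))
  where
  split : ∀ x (d : Dec (x ≡ y)) → ⟦ P? x ⟧ ≤ ⟦ d ⟧ + ⟦ P? x ×-dec ¬? d ⟧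
  split x (yes e) = ≤-trans (⟦⟧≤1 (P? x)) (≤-trans (≤-reflexive (sym (⟦⟧-yes (yes e) e))) (m≤m+n _ _))
  split x (no x≢y) = m≤n⇒m≤o+n _ (⟦⟧-mono (P? x) (P? x ×-dec ¬? (no x≢y)) (λ p → p , x≢y))

#-fresh : {P : Fin n → Set} (P? : Decidable P) (xs : Vec (Fin n) l) → l < # P? →
  ∃ λ x → P x × Allᵛ (x ≢_) xs
#-fresh {n} {l} P? xs l<#
  with any? (λ x → P? x ×-dec All.all? (λ y → ¬? (x ≟ y)) xs)
... | yes (x , p , fr) = x , p , fr
-- If every element satisfying `P` occurred in `xs`, charging each to a position holding it would
-- bound their number by `l`.
... | no none = contradiction l<# (≤⇒≯ (begin
    # P?                                       ≤⟨ ∑-mono covered ⟩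
    ∑ (λ x → ∑ (λ j → ⟦ x ≟ lookup xs j ⟧))    ≡⟨ ∑-comm (λ x j → ⟦ x ≟ lookup xs j ⟧) ⟩
    ∑ (λ j → # (_≟ lookup xs j))               ≤⟨ ∑-bound (λ j → #≡ (lookup xs j)) ⟩
    l * 1                                      ≡⟨ *-identityʳ l ⟩
    l ∎))
  where
  open ≤-Reasoning
  covered : ∀ x → ⟦ P? x ⟧ ≤ ∑ (λ j → ⟦ x ≟ lookup xs j ⟧)
  covered x = ⟦⟧-≤ (P? x) λ p → hit p (any? (λ j → x ≟ lookup xs j))
    where
    hit : _ → Dec (∃ λ j → x ≡ lookup xs j) → 1 ≤ ∑ (λ j → ⟦ x ≟ lookup xs j ⟧)
    hit p (yes (j , eq)) = ≤-trans (≤-reflexive (sym (⟦⟧-yes (x ≟ lookup xs j) eq))) (term≤∑ (λ j → ⟦ x ≟ lookup xs j ⟧) j)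
    hit p (no ¬j) = contradiction (x , p , AllP.lookup⁻ (λ j eq → ¬j (j , eq))) none

#-select : {P : Fin n → Set} (P? : Decidable P) → l ≤ # P? →
  ∃ λ (xs : Vec (Fin n) l) → Uniqueᵛ xs × Allᵛ P xs
#-select {l = zero} P? _ = [] , [] , []
#-select {l = suc l} P? l<# with #-select {l = l} P? (<⇒≤ l<#)
... | xs , u , ps with #-fresh P? xs l<#
...   | x , p , fr = x ∷ xs , fr ∷ u , p ∷ ps

#-unique : {P : Fin n → Set} (P? : Decidable P) (xs : Vec (Fin n) l) → Uniqueᵛ xs → Allᵛ P xs → l ≤ # P?
#-unique {n} {l} P? xs u ps = begin
  l                                          ≡⟨ *-identityʳ l ⟨
  l * 1                                      ≡⟨ ∑-const l 1 ⟨
  ∑ {l} (λ j → 1)                            ≤⟨ ∑-mono {l} (λ j → ≤-trans (≤-reflexive (sym (⟦⟧-yes (lookup xs j ≟ lookup xs j) refl))) (term≤∑ (λ x → ⟦ x ≟ lookup xs j ⟧) (lookup xs j))) ⟩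
  ∑ (λ j → # (_≟ lookup xs j))               ≡⟨ ∑-comm (λ j x → ⟦ x ≟ lookup xs j ⟧) ⟩
  ∑ (λ x → ∑ (λ j → ⟦ x ≟ lookup xs j ⟧))    ≤⟨ ∑-mono once ⟩
  # P? ∎
  where
  open ≤-Reasoning
  once : ∀ x → ∑ (λ j → ⟦ x ≟ lookup xs j ⟧) ≤ ⟦ P? x ⟧
  once x = #≤⟦⟧ (λ j → x ≟ lookup xs j) (P? x)
    (λ j eq → subst _ (sym eq) (AllP.lookup⁺ ps j))
    (λ _ i j p q → lookup-injective u i j (trans (sym p) q))

opaque
  unfolding ⟦_⟧

  ∣∣≡# : (A : Subset n) → ∣ A ∣ ≡ # (_∈? A)
  ∣∣≡# [] = sym (∑-zero _)
  ∣∣≡# (x ∷ A) = trans (head-tail x) (sym (∑-suc λ i → ⟦ i ∈? (x ∷ A) ⟧))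
    where
    shift : ∀ x {i} (d : Dec (i ∈ A)) → ⟦ d ⟧ ≡ ⟦ map′ (there {y = x}) drop-there d ⟧
    shift x (yes _) = refl
    shift x (no _) = refl
    head-tail : ∀ x → ∣ x ∷ A ∣ ≡ ⟦ zero ∈? (x ∷ A) ⟧ + # (λ i → suc i ∈? (x ∷ A))
    head-tail inside = cong suc (trans (∣∣≡# A) (∑-cong λ i → shift inside (i ∈? A)))
    head-tail outside = trans (∣∣≡# A) (∑-cong λ i → shift outside (i ∈? A))

-- Sums over tuples of vertices.

∑ᵛ : ∀ l → (Vec (Fin n) l → ℕ) → ℕ
∑ᵛ zero f = f []
∑ᵛ (suc l) f = ∑ λ x → ∑ᵛ l λ p → f (x ∷ p)

∑ᵛ-mono : ∀ l {f g : Vec (Fin n) l → ℕ} → (∀ p → f p ≤ g p) → ∑ᵛ l f ≤ ∑ᵛ l g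
∑ᵛ-mono zero h = h []
∑ᵛ-mono (suc l) h = ∑-mono λ x → ∑ᵛ-mono l λ p → h (x ∷ p)

∑ᵛ-distrib-+ : ∀ l (f g : Vec (Fin n) l → ℕ) → ∑ᵛ l (λ p → f p + g p) ≡ ∑ᵛ l f + ∑ᵛ l g
∑ᵛ-distrib-+ zero f g = refl
∑ᵛ-distrib-+ (suc l) f g = trans
  (∑-cong λ x → ∑ᵛ-distrib-+ l (f ∘ (x ∷_)) (g ∘ (x ∷_)))
  (∑-distrib-+ (λ x → ∑ᵛ l (f ∘ (x ∷_))) _)

*-∑ᵛ : ∀ c l (f : Vec (Fin n) l → ℕ) → c * ∑ᵛ l f ≡ ∑ᵛ l (λ p → c * f p)
*-∑ᵛ c zero f = refl
*-∑ᵛ c (suc l) f = trans (*-∑ c _) (∑-cong λ x → *-∑ᵛ c l (f ∘ (x ∷_)))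

∑ᵛ-const : ∀ l c → ∑ᵛ {n} l (λ _ → c) ≡ n ^ l * c
∑ᵛ-const zero c = sym (*-identityˡ c)
∑ᵛ-const {n} (suc l) c = trans (∑-cong λ x → ∑ᵛ-const l c)
  (trans (∑-const n (n ^ l * c)) (sym (*-assoc n (n ^ l) c)))

∑-∑ᵛ-comm : ∀ {m} l (f : Fin m → Vec (Fin n) l → ℕ) →
  ∑ (λ i → ∑ᵛ l (f i)) ≡ ∑ᵛ l (λ p → ∑ λ i → f i p)
∑-∑ᵛ-comm zero f = refl
∑-∑ᵛ-comm (suc l) f = trans (∑-comm λ i x → ∑ᵛ l (f i ∘ (x ∷_)))
  (∑-cong λ x → ∑-∑ᵛ-comm l (λ i p → f i (x ∷ p)))

term≤∑ᵛ : ∀ l (f : Vec (Fin n) l → ℕ) p → f p ≤ ∑ᵛ l f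
term≤∑ᵛ zero f [] = ≤-refl
term≤∑ᵛ (suc l) f (x ∷ p) = ≤-trans (term≤∑ᵛ l (f ∘ (x ∷_)) p) (term≤∑ (λ x → ∑ᵛ l (f ∘ (x ∷_))) x)

-- Averaging, one coordinate at a time: a strictly larger sum has a strictly larger slice.
∑ᵛ-compare : ∀ l (f g : Vec (Fin n) l → ℕ) → ∑ᵛ l f < ∑ᵛ l g → ∃ λ p → f p < g p
∑ᵛ-compare zero f g h = [] , h
∑ᵛ-compare {n} (suc l) f g h
  with any? (λ x → ∑ᵛ l (f ∘ (x ∷_)) <? ∑ᵛ l (g ∘ (x ∷_)))
... | yes (x , lt) = let p , q = ∑ᵛ-compare l _ _ lt in x ∷ p , q
... | no none = contradiction h (≤⇒≯ (∑-mono λ x → ≮⇒≥ λ lt → none (x , lt)))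

∑ᵛ-all : ∀ l {P : Fin n → Set} (P? : Decidable P) → ∑ᵛ l (λ p → ⟦ All.all? P? p ⟧) ≤ # P? ^ l
∑ᵛ-all zero P? = ⟦⟧≤1 (All.all? P? [])
∑ᵛ-all {n} (suc l) P? = begin
  ∑ (λ x → ∑ᵛ l (λ p → ⟦ All.all? P? (x ∷ p) ⟧))          ≤⟨ ∑-mono (λ x → ∑ᵛ-mono l (λ p → split x p)) ⟩
  ∑ (λ x → ∑ᵛ l (λ p → ⟦ P? x ⟧ * ⟦ All.all? P? p ⟧))     ≡⟨ ∑-cong (λ x → *-∑ᵛ ⟦ P? x ⟧ l _) ⟨
  ∑ (λ x → ⟦ P? x ⟧ * ∑ᵛ l (λ p → ⟦ All.all? P? p ⟧))     ≤⟨ ∑-mono (λ x → *-monoʳ-≤ ⟦ P? x ⟧ (∑ᵛ-all l P?)) ⟩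
  ∑ (λ x → ⟦ P? x ⟧ * # P? ^ l)                           ≡⟨ ∑-cong (λ x → *-comm ⟦ P? x ⟧ (# P? ^ l)) ⟩
  ∑ (λ x → # P? ^ l * ⟦ P? x ⟧)                           ≡⟨ *-∑ (# P? ^ l) _ ⟨
  # P? ^ l * # P?                                         ≡⟨ *-comm (# P? ^ l) (# P?) ⟩
  # P? ^ suc l ∎
  where
  open ≤-Reasoning
  split : ∀ x p → ⟦ All.all? P? (x ∷ p) ⟧ ≤ ⟦ P? x ⟧ * ⟦ All.all? P? p ⟧
  split x p = ⟦⟧-≤ (All.all? P? (x ∷ p)) λ { (h ∷ hs) → ≤-reflexive (sym (cong₂ _*_ (⟦⟧-yes (P? x) h) (⟦⟧-yes (All.all? P? p) hs))) }

-- Counting arrangements of distinct elements.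

unique? : (p : Vec (Fin n) l) → Dec (Uniqueᵛ p)
unique? = allPairs? λ x y → ¬? (x ≟ y)

arrangement? : {P : Fin n → Set} → Decidable P → (p : Vec (Fin n) l) → Dec (Uniqueᵛ p × Allᵛ P p)
arrangement? P? p = unique? p ×-dec All.all? P? p

#-arrangements : ∀ l {P : Fin n → Set} (P? : Decidable P) → l ≤ # P? →
  l ! ≤ ∑ᵛ l (λ p → ⟦ arrangement? P? p ⟧)
#-arrangements zero P? _ = ≤-reflexive (sym (⟦⟧-yes (arrangement? P? []) ([] , [])))
#-arrangements {n} (suc l) {P} P? l<# = begin
  -- Any of at least `l + 1` elements may come first, and at least `l` others remain for the other
  -- places.
  suc l * l !                                  ≤⟨ *-monoˡ-≤ (l !) l<# ⟩
  # P? * l !                                   ≡⟨ *-comm (# P?) (l !) ⟩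
  l ! * # P?                                   ≡⟨ *-∑ (l !) _ ⟩
  ∑ (λ x → l ! * ⟦ P? x ⟧)                     ≡⟨ ∑-cong (λ x → *-comm (l !) ⟦ P? x ⟧) ⟩
  ∑ (λ x → ⟦ P? x ⟧ * l !)                     ≤⟨ ∑-mono (λ x → ⟦⟧*-≤ (P? x) (rest x)) ⟩
  ∑ (λ x → ∑ᵛ l (λ p → ⟦ arrangement? P? (x ∷ p) ⟧)) ∎
  where
  open ≤-Reasoning
  rest : ∀ x → P x → l ! ≤ ∑ᵛ l (λ p → ⟦ arrangement? P? (x ∷ p) ⟧)
  rest x px = ≤-trans
    (#-arrangements l P∖x? (s≤s⁻¹ (≤-trans l<# (#-delete P? x))))
    (∑ᵛ-mono l λ p → ⟦⟧-mono (arrangement? P∖x? p) (arrangement? P? (x ∷ p))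
      λ (u , ps) → All.map (λ (_ , y≢x) x≡y → y≢x (sym x≡y)) ps ∷ u , px ∷ All.map proj₁ ps)
    where
    P∖x? : Decidable (λ y → P y × y ≢ x)
    P∖x? y = P? y ×-dec ¬? (y ≟ x)

#-saturated : {P Q : Fin n → Set} (P? : Decidable P) (Q? : Decidable Q) → (∀ i → P i → Q i) →
  # Q? ≤ # P? → ∀ x → Q x → P x
#-saturated P? Q? P⇒Q Q≤P x qx with P? x
... | yes px = px
... | no ¬px = contradiction (begin-strict
  # P?                                   <⟨ +-monoʳ-≤ 1 ≤-refl ⟩
  1 + # P?                               ≡⟨ cong (_+ # P?) (⟦⟧-yes (x ≟ x) refl) ⟨
  ⟦ x ≟ x ⟧ + # P?                       ≤⟨ +-monoˡ-≤ _ (term≤∑ (λ i → ⟦ i ≟ x ⟧) x) ⟩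
  # (_≟ x) + # P?                        ≡⟨ ∑-distrib-+ (λ i → ⟦ i ≟ x ⟧) _ ⟨
  ∑ (λ i → ⟦ i ≟ x ⟧ + ⟦ P? i ⟧)         ≤⟨ ∑-mono (λ i → disjoint i (i ≟ x)) ⟩
  # Q? ∎) (≤⇒≯ Q≤P)
  where
  open ≤-Reasoning
  disjoint : ∀ i (e : Dec (i ≡ x)) → ⟦ e ⟧ + ⟦ P? i ⟧ ≤ ⟦ Q? i ⟧
  disjoint i (yes refl) = ≤-reflexive (trans (cong₂ _+_ (⟦⟧-yes (yes refl) refl) (⟦⟧-no (P? x) ¬px)) (sym (⟦⟧-yes (Q? x) qx)))
  disjoint i (no i≢x) = ≤-trans (≤-reflexive (cong (_+ ⟦ P? i ⟧) (⟦⟧-no (no i≢x) i≢x))) (⟦⟧-mono (P? i) (Q? i) (P⇒Q i))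

-- Subsets cut out by decidable predicates.

⟪_⟫ : {P : Fin n → Set} → Decidable P → Subset n
⟪ P? ⟫ = tabulate λ i → does (P? i)

∈⟪⟫⁻ : {P : Fin n → Set} (P? : Decidable P) → ∀ {x} → x ∈ ⟪ P? ⟫ → P x
∈⟪⟫⁻ P? {x} x∈ = holds (P? x) (trans (sym (lookup∘tabulate (λ i → does (P? i)) x)) ([]=⇒lookup x∈))
  where
  holds : (p : Dec P) → does p ≡ true → P
  holds (yes p) _ = p

∈⟪⟫⁺ : {P : Fin n → Set} (P? : Decidable P) → ∀ {x} → P x → x ∈ ⟪ P? ⟫
∈⟪⟫⁺ P? {x} px = lookup⇒[]= x _ (trans (lookup∘tabulate (λ i → does (P? i)) x) (true! (P? x) px))
  where
  true! : (p : Dec P) → P → does p ≡ true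
  true! (yes _) _ = refl
  true! (no ¬p) p = contradiction p ¬p

∣⟪⟫∣ : {P : Fin n → Set} (P? : Decidable P) → ∣ ⟪ P? ⟫ ∣ ≡ # P?
∣⟪⟫∣ P? = trans (∣∣≡# ⟪ P? ⟫) (≤-antisym
  (#-mono (_∈? ⟪ P? ⟫) P? λ _ → ∈⟪⟫⁻ P?) (#-mono P? (_∈? ⟪ P? ⟫) λ _ → ∈⟪⟫⁺ P?))

-- Cycles of kernel sets.

-- The incidence conditions of `ContainsCycle` without membership in `𝓕`, so that the edges may be
-- kernel sets still to be enlarged.
CycleShape : ∀ {n} m → (Fin (suc m) → Subset n) → (Fin (suc m) → Fin n) → Set
CycleShape {n} m D v =
  (∀ i j → v i ≡ v j → i ≡ j) ×
  (∀ i j → (v j ∈ D i → (j ≡ i ⊎ j ≡ cycSuc i))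
         × ((j ≡ i ⊎ j ≡ cycSuc i) → v j ∈ D i)) ×
  (∀ i j (x : Fin n) → (∀ r → v r ≢ x) → x ∈ D i → x ∈ D j → i ≡ j)

_[_≔_] : {A : Set} → (Fin n → A) → Fin n → A → Fin n → A
(D [ i ≔ F ]) j with j ≟ i
... | yes _ = F
... | no _ = D j

module _ {m} {D : Fin (suc m) → Subset n} {v : Fin (suc m) → Fin n} where

  shape-replace : CycleShape m D v → ∀ i F → D i ⊆ F →
    (∀ j → j ≢ i → ∀ {x} → x ∈ F → x ∈ D j → x ∈ D i) → CycleShape m (D [ i ≔ F ]) v
  shape-replace (inj , inc , dis) i F D⊆F meet = inj , inc′ , dis′
    where
    inc′ : ∀ i′ j → (v j ∈ (D [ i ≔ F ]) i′ → (j ≡ i′ ⊎ j ≡ cycSuc i′)) × ((j ≡ i′ ⊎ j ≡ cycSuc i′) → v j ∈ (D [ i ≔ F ]) i′)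
    inc′ i′ j with i′ ≟ i
    ... | no _ = inc i′ j
    ... | yes refl = (λ v∈F → proj₁ (inc i j) (back v∈F (j ≟ i))) , (D⊆F ∘ proj₂ (inc i j))
      where
      back : v j ∈ F → Dec (j ≡ i) → v j ∈ D i
      back v∈F (yes refl) = proj₂ (inc i i) (inj₁ refl)
      back v∈F (no j≢i) = meet j j≢i v∈F (proj₂ (inc j j) (inj₁ refl))
    dis′ : ∀ i′ j x → (∀ r → v r ≢ x) → x ∈ (D [ i ≔ F ]) i′ → x ∈ (D [ i ≔ F ]) j → i′ ≡ j
    dis′ i′ j x off p q with i′ ≟ i | j ≟ i
    ... | yes refl | yes refl = refl
    ... | yes refl | no j≢i = dis i j x off (meet j j≢i p q) q
    ... | no i′≢i | yes refl = dis i′ i x off p (meet i′ i′≢i q p)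
    ... | no _ | no _ = dis i′ j x off p q

module _ {k m : ℕ} {𝓕 : Family n} (1≤k : 1 ≤ k) (uniform : ∀ F → F ∈ˡ 𝓕 → ∣ F ∣ ≡ k) where

  InKer-size : ∀ {D} → InKer (k * suc m) 𝓕 D → ∣ D ∣ ≤ k
  InKer-size {D} (F , F∈ , D⊂F , _) = ≤-trans (p⊆q⇒∣p∣≤∣q∣ (proj₁ (D⊂F i))) (≤-reflexive (uniform _ (F∈ i)))
    where
    i : Fin (k * suc m)
    -- The threshold `k * suc m` is positive, so there is a petal to compare sizes with.
    i = fromℕ< (*-mono-≤ 1≤k (s≤s (z≤n {m})))

  -- The petals over D i are disjoint outside D i, and fewer than k(m+1) vertices must be avoided.
  free-petal : (D : Fin (suc m) → Subset n) → (∀ j → ∣ D j ∣ ≤ k) → ∀ i → InKer (k * suc m) 𝓕 (D i) →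
    ∃ λ F → F ∈ˡ 𝓕 × D i ⊆ F × (∀ j → j ≢ i → ∀ {x} → x ∈ F → x ∈ D j → x ∈ D i)
  free-petal D small i (F , F∈ , D⊂F , sun) = found (any? free?)
    where
    open ≤-Reasoning
    Blocked : Fin n → Set
    Blocked x = (∃ λ j → j ≢ i × x ∈ D j) × x ∉ D i
    blocked? : Decidable Blocked
    blocked? x = any? (λ j → ¬? (j ≟ i) ×-dec x ∈? D j) ×-dec ¬? (x ∈? D i)
    free? : Decidable (λ r → ∀ x → x ∈ F r → ¬ Blocked x)
    free? r = all? λ x → (x ∈? F r) →-dec ¬? (blocked? x)
    hits? : ∀ r → Decidable (λ x → x ∈ F r × Blocked x)
    hits? r x = (x ∈? F r) ×-dec blocked? x
    once : ∀ x → ∑ (λ r → ⟦ hits? r x ⟧) ≤ ⟦ blocked? x ⟧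
    once x = #≤⟦⟧ (λ r → hits? r x) (blocked? x) (λ _ → proj₂) same
      where
      same : Blocked x → ∀ r r′ → x ∈ F r × Blocked x → x ∈ F r′ × Blocked x → r ≡ r′
      same b r r′ (p , _) (p′ , _) with r ≟ r′
      ... | yes eq = eq
      ... | no r≢r′ = contradiction (subst (x ∈_) (sun r r′ r≢r′) (x∈p∩q⁺ (p , p′))) (proj₂ b)
    others : ∀ x → ⟦ blocked? x ⟧ ≤ ∑ (λ j → ⟦ ¬? (j ≟ i) ×-dec x ∈? D j ⟧)
    others x = ⟦⟧-≤ (blocked? x) λ { ((j , j≢i , x∈D) , _) → ≤-trans
      (≤-reflexive (sym (⟦⟧-yes (¬? (j ≟ i) ×-dec x ∈? D j) (j≢i , x∈D))))
      (term≤∑ (λ j → ⟦ ¬? (j ≟ i) ×-dec x ∈? D j ⟧) j) }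
    size : ∀ j → # (λ x → ¬? (j ≟ i) ×-dec x ∈? D j) ≤ k * ⟦ ¬? (j ≟ i) ⟧
    size j with j ≟ i
    ... | yes j≡i = ≤-trans (∑-bound λ x → ≤-reflexive (⟦⟧-no (¬? (yes j≡i) ×-dec x ∈? D j) λ (j≢i , _) → j≢i j≡i)) (≤-trans (≤-reflexive (*-zeroʳ n)) z≤n)
    ... | no j≢i = begin
      # (λ x → ¬? (no j≢i) ×-dec x ∈? D j) ≤⟨ #-mono (λ x → ¬? (no j≢i) ×-dec x ∈? D j) (_∈? D j) (λ _ → proj₂) ⟩
      # (_∈? D j)                          ≡⟨ ∣∣≡# (D j) ⟨
      ∣ D j ∣                              ≤⟨ small j ⟩
      k                                    ≡⟨ *-identityʳ k ⟨
      k * 1                                ≡⟨ cong (k *_) (⟦⟧-yes (¬? (no j≢i)) j≢i) ⟨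
      k * ⟦ ¬? (no j≢i) ⟧ ∎
    except-one : # (λ j → ¬? (j ≟ i)) ≤ m
    except-one = s≤s⁻¹ (begin
      suc (# (λ j → ¬? (j ≟ i)))                    ≤⟨ +-monoˡ-≤ _ (≤-trans (≤-reflexive (sym (⟦⟧-yes (i ≟ i) refl))) (term≤∑ (λ j → ⟦ j ≟ i ⟧) i)) ⟩
      # (_≟ i) + # (λ j → ¬? (j ≟ i))               ≡⟨ ∑-distrib-+ (λ j → ⟦ j ≟ i ⟧) _ ⟨
      ∑ (λ j → ⟦ j ≟ i ⟧ + ⟦ ¬? (j ≟ i) ⟧)          ≤⟨ ∑-bound (λ j → excl j (j ≟ i)) ⟩
      suc m * 1                                     ≡⟨ *-identityʳ (suc m) ⟩
      suc m ∎)
      where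
      excl : ∀ j (d : Dec (j ≡ i)) → ⟦ d ⟧ + ⟦ ¬? d ⟧ ≤ 1
      excl j (yes e) = ≤-reflexive (cong₂ _+_ (⟦⟧-yes (yes e) e) (⟦⟧-no (¬? (yes e)) λ h → h e))
      excl j (no e) = ≤-reflexive (cong₂ _+_ (⟦⟧-no (no e) e) (⟦⟧-yes (¬? (no e)) e))
    found : Dec (∃ λ r → ∀ x → x ∈ F r → ¬ Blocked x) → _
    found (yes (r , free)) = F r , F∈ r , (λ {x} → proj₁ (D⊂F r) {x}) , λ j j≢i {x} x∈F x∈D →
      decidable-stable (x ∈? D i) λ x∉ → free x x∈F ((j , j≢i , x∈D) , x∉)
    found (no none) = contradiction (begin-strict
      k * suc m                                           ≡⟨ *-identityʳ _ ⟨
      k * suc m * 1                                       ≡⟨ ∑-const (k * suc m) 1 ⟨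
      ∑ {k * suc m} (λ r → 1)                             ≤⟨ ∑-mono hit ⟩
      ∑ (λ r → # (hits? r))                               ≡⟨ ∑-comm (λ r x → ⟦ hits? r x ⟧) ⟩
      ∑ (λ x → ∑ (λ r → ⟦ hits? r x ⟧))                   ≤⟨ ∑-mono (λ x → ≤-trans (once x) (others x)) ⟩
      ∑ (λ x → ∑ (λ j → ⟦ ¬? (j ≟ i) ×-dec x ∈? D j ⟧))   ≡⟨ ∑-comm (λ x j → ⟦ ¬? (j ≟ i) ×-dec x ∈? D j ⟧) ⟩
      ∑ (λ j → # (λ x → ¬? (j ≟ i) ×-dec x ∈? D j))       ≤⟨ ∑-mono size ⟩
      ∑ (λ j → k * ⟦ ¬? (j ≟ i) ⟧)                        ≡⟨ *-∑ k (λ j → ⟦ ¬? (j ≟ i) ⟧) ⟨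
      k * # (λ j → ¬? (j ≟ i))                            ≤⟨ *-monoʳ-≤ k except-one ⟩
      k * m                                               <⟨ *-monoʳ-< k {{>-nonZero 1≤k}} (n<1+n m) ⟩
      k * suc m ∎) (<-irrefl refl)
      where
      hit : ∀ r → 1 ≤ # (hits? r)
      hit r with any? (hits? r)
      ... | yes (x , h) = ≤-trans (≤-reflexive (sym (⟦⟧-yes (hits? r x) h))) (term≤∑ (λ x → ⟦ hits? r x ⟧) x)
      ... | no ¬h = contradiction (r , λ x x∈F b → ¬h (x , x∈F , b)) none

  -- Indices are processed one at a time. Every edge, replaced or not, has at most `k` elements
  -- throughout, so `free-petal` applies at each step.
  kernel-cycle : (D : Fin (suc m) → Subset n) (v : Fin (suc m) → Fin n) → CycleShape m D v →
    (∀ i → InKer (k * suc m) 𝓕 (D i)) → ContainsCycle m 𝓕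
  kernel-cycle D v shape ker = fill (allFin (suc m)) D shape λ i → inj₂ (∈-allFin i , ker i)
    where
    -- Each edge is a member already, or is a kernel set whose index is still listed; once the list
    -- is empty, all edges are members.
    Todo : List (Fin (suc m)) → (Fin (suc m) → Subset n) → Set
    Todo js D = ∀ i → D i ∈ˡ 𝓕 ⊎ (i ∈ˡ js × InKer (k * suc m) 𝓕 (D i))
    fill : ∀ js D → CycleShape m D v → Todo js D → ContainsCycle m 𝓕
    fill [] D shape todo = D , v , (λ i → [ id , (λ ()) ]′ (todo i)) , shape
    fill (i ∷ js) D shape todo with todo i
    ... | inj₁ D∈ = fill js D shape skip
      where
      skip : Todo js D
      skip j with todo j
      ... | inj₁ p = inj₁ p
      ... | inj₂ (here refl , _) = inj₁ D∈
      ... | inj₂ (there j∈ , kj) = inj₂ (j∈ , kj)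
    ... | inj₂ (_ , ki) with free-petal D (λ j → [ (λ p → ≤-reflexive (uniform _ p)) , InKer-size ∘ proj₂ ]′ (todo j)) i ki
    ...   | F , F∈ , D⊆F , meet = fill js (D [ i ≔ F ]) (shape-replace shape i F D⊆F meet) next
      where
      next : Todo js (D [ i ≔ F ])
      next j with j ≟ i
      ... | yes _ = inj₁ F∈
      ... | no j≢i with todo j
      ...   | inj₁ p = inj₁ p
      ...   | inj₂ (here eq , _) = contradiction eq j≢i
      ...   | inj₂ (there j∈ , kj) = inj₂ (j∈ , kj)

-- Kernel cycles from cyclic sequences of vertices.

cycSuc-inject₁ : (j : Fin m) → cycSuc (inject₁ j) ≡ suc j
cycSuc-inject₁ {m} j = toℕ-injective (trans (toℕ-fromℕ< _)
  (trans (cong (λ i → suc i % suc m) (toℕ-inject₁ j)) (m<n⇒m%n≡m (s≤s (toℕ<n j)))))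

cycSuc-fromℕ : ∀ m → cycSuc (fromℕ m) ≡ zero
cycSuc-fromℕ m = toℕ-injective (trans (toℕ-fromℕ< _)
  (trans (cong (λ i → suc i % suc m) (toℕ-fromℕ m)) (n%n≡0 (suc m))))

Linked-lookup : {A : Set} {R : A → A → Set} {xs : Vec A (suc m)} → Linked R xs →
  ∀ j → R (lookup xs (inject₁ j)) (lookup xs (suc j))
Linked-lookup {xs = x ∷ y ∷ xs} (r ∷ rs) zero = r
Linked-lookup {xs = x ∷ y ∷ xs} (r ∷ rs) (suc j) = Linked-lookup rs j

last-lookup : {A : Set} (xs : Vec A (suc m)) → last xs ≡ lookup xs (fromℕ m)
last-lookup (x ∷ []) = refl
last-lookup (x ∷ y ∷ xs) = last-lookup (y ∷ xs)

Linked-cyclic : {A : Set} {R : A → A → Set} (xs : Vec A (suc m)) → Linked R xs →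
  R (last xs) (head xs) → ∀ i → R (lookup xs i) (lookup xs (cycSuc i))
Linked-cyclic {m} {R = R} xs@(x ∷ _) rs close i with view i
... | ‵fromℕ = subst (R (lookup xs (fromℕ m))) (sym (cong (lookup xs) (cycSuc-fromℕ m))) (subst (λ y → R y x) (last-lookup xs) close)
... | ‵inject₁ j = subst (R (lookup xs (inject₁ j))) (sym (cong (lookup xs) (cycSuc-inject₁ j))) (Linked-lookup rs j)

pair-∈ˡ : ∀ (x y : Fin n) → x ∈ ⁅ x ⁆ ∪ ⁅ y ⁆
pair-∈ˡ x y = x∈p∪q⁺ (inj₁ (x∈⁅x⁆ x))

pair-∈ʳ : ∀ (x y : Fin n) → y ∈ ⁅ x ⁆ ∪ ⁅ y ⁆
pair-∈ʳ x y = x∈p∪q⁺ (inj₂ (x∈⁅x⁆ y))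

∈-pair : ∀ {x y z : Fin n} → z ∈ ⁅ x ⁆ ∪ ⁅ y ⁆ → z ≡ x ⊎ z ≡ y
∈-pair {x = x} {y} z∈ = ⊎-map (x∈⁅y⁆⇒x≡y x) (x∈⁅y⁆⇒x≡y y) (x∈p∪q⁻ _ _ z∈)

-- A private vertex is allowed in the first edge only, so no two edges share one.
shape-from-pairs : (D : Fin (suc m) → Subset n) (v : Fin (suc m) → Fin n) →
  (∀ i j → v i ≡ v j → i ≡ j) →
  (∀ i → v i ∈ D i × v (cycSuc i) ∈ D i) →
  (∀ i x → x ∈ D i → x ≡ v i ⊎ x ≡ v (cycSuc i) ⊎ (i ≡ zero × (∀ r → v r ≢ x))) →
  CycleShape m D v
shape-from-pairs D v inj ends only = inj , inc , dis
  where
  inc : ∀ i j → (v j ∈ D i → (j ≡ i ⊎ j ≡ cycSuc i)) × ((j ≡ i ⊎ j ≡ cycSuc i) → v j ∈ D i)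
  inc i j = to , λ { (inj₁ refl) → proj₁ (ends i) ; (inj₂ refl) → proj₂ (ends i) }
    where
    to : v j ∈ D i → j ≡ i ⊎ j ≡ cycSuc i
    to v∈ with only i (v j) v∈
    ... | inj₁ eq = inj₁ (inj _ _ eq)
    ... | inj₂ (inj₁ eq) = inj₂ (inj _ _ eq)
    ... | inj₂ (inj₂ (_ , off)) = contradiction refl (off j)
  first : ∀ i x → (∀ r → v r ≢ x) → x ∈ D i → i ≡ zero
  first i x off x∈ with only i x x∈
  ... | inj₁ eq = contradiction (sym eq) (off _)
  ... | inj₂ (inj₁ eq) = contradiction (sym eq) (off _)
  ... | inj₂ (inj₂ (i≡0 , _)) = i≡0
  dis : ∀ i j x → (∀ r → v r ≢ x) → x ∈ D i → x ∈ D j → i ≡ j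
  dis i j x off p q = trans (first i x off p) (sym (first j x off q))

Kernel-pair : ℕ → Family n → Fin n → Fin n → Set
Kernel-pair s 𝓕 x y = InKer s 𝓕 (⁅ x ⁆ ∪ ⁅ y ⁆)

module _ {k : ℕ} {𝓕 : Family n} (1≤k : 1 ≤ k) (uniform : ∀ F → F ∈ˡ 𝓕 → ∣ F ∣ ≡ k) where

  graph-cycle : (xs : Vec (Fin n) (suc m)) → Uniqueᵛ xs → Linked (Kernel-pair (k * suc m) 𝓕) xs →
    Kernel-pair (k * suc m) 𝓕 (last xs) (head xs) → ContainsCycle m 𝓕
  graph-cycle xs u ks close = kernel-cycle 1≤k uniform (λ i → ⁅ lookup xs i ⁆ ∪ ⁅ lookup xs (cycSuc i) ⁆) (lookup xs)
    (shape-from-pairs _ _ (lookup-injective u) (λ i → pair-∈ˡ _ _ , pair-∈ʳ _ _)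
      (λ i x x∈ → ⊎-map₂ inj₁ (∈-pair x∈)))
    (Linked-cyclic xs ks close)

  -- The cycle runs through `x ∷ y ∷ zs`. The triple replaces the two pairs at `e`, and `e` becomes
  -- the private vertex of the first edge.
  shortcut-cycle : ∀ x e y (zs : Vec (Fin n) m) → Uniqueᵛ (x ∷ e ∷ y ∷ zs) →
    InKer (k * (2 + m)) 𝓕 (⁅ e ⁆ ∪ (⁅ x ⁆ ∪ ⁅ y ⁆)) → Linked (Kernel-pair (k * (2 + m)) 𝓕) (y ∷ zs) →
    Kernel-pair (k * (2 + m)) 𝓕 (last (y ∷ zs)) x → ContainsCycle (suc m) 𝓕
  shortcut-cycle {m} x e y zs ((x≢e ∷ x≢) ∷ e≢ ∷ u) triple ks close =
    kernel-cycle 1≤k uniform D v (shape-from-pairs D v (lookup-injective (x≢ ∷ u)) ends only) ker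
    where
    K₂ : Fin n → Fin n → Set
    K₂ = Kernel-pair (k * (2 + m)) 𝓕
    v : Fin (suc (suc m)) → Fin n
    v = lookup (x ∷ y ∷ zs)
    D : Fin (suc (suc m)) → Subset n
    D zero = ⁅ e ⁆ ∪ (⁅ x ⁆ ∪ ⁅ y ⁆)
    D (suc i) = ⁅ v (suc i) ⁆ ∪ ⁅ v (cycSuc (suc i)) ⁆
    off : ∀ r → v r ≢ e
    off zero eq = x≢e eq
    off (suc r) eq = AllP.lookup⁺ e≢ r (sym eq)
    ends : ∀ i → v i ∈ D i × v (cycSuc i) ∈ D i
    ends zero = x∈p∪q⁺ (inj₂ (pair-∈ˡ x y)) , x∈p∪q⁺ (inj₂ (pair-∈ʳ x y))
    ends (suc i) = pair-∈ˡ _ _ , pair-∈ʳ _ _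
    only : ∀ i z → z ∈ D i → z ≡ v i ⊎ z ≡ v (cycSuc i) ⊎ (i ≡ zero × (∀ r → v r ≢ z))
    only zero z z∈ with x∈p∪q⁻ _ _ z∈
    ... | inj₁ z∈e = inj₂ (inj₂ (refl , λ r eq → off r (trans eq (x∈⁅y⁆⇒x≡y e z∈e))))
    ... | inj₂ z∈xy = ⊎-map₂ inj₁ (∈-pair z∈xy)
    only (suc i) z z∈ = ⊎-map₂ inj₁ (∈-pair z∈)
    ker : ∀ i → InKer (k * (2 + m)) 𝓕 (D i)
    ker zero = triple
    ker (suc i) with view i
    ... | ‵fromℕ = subst (K₂ (v (fromℕ (suc m)))) (sym (cong v (cycSuc-fromℕ (suc m)))) (subst (λ z → K₂ z x) (last-lookup (y ∷ zs)) close)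
    ... | ‵inject₁ j = subst (K₂ (v (suc (inject₁ j)))) (sym (cong v (cycSuc-inject₁ (suc j)))) (Linked-lookup ks j)

-- Walks in bipartite graphs.

-- A walk in the bipartite graph G, starting on the side of the first argument.
Walk : (Fin n → Fin n → Set) → Vec (Fin n) (suc l) → Set
Walk G (x ∷ []) = ⊤
Walk G (x ∷ y ∷ xs) = G x y × Walk (λ a b → G b a) (y ∷ xs)

Walk-map : {G H : Fin n → Fin n → Set} → (∀ a b → G a b → H a b) →
  (xs : Vec (Fin n) (suc l)) → Walk G xs → Walk H xs
Walk-map f (x ∷ []) _ = tt
Walk-map f (x ∷ y ∷ xs) (g , w) = f x y g , Walk-map (λ a b → f b a) (y ∷ xs) w

Walk-all : {P : Fin n → Set} {G : Fin n → Fin n → Set} → (∀ a b → G a b → P a × P b) →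
  (xs : Vec (Fin n) (suc (suc l))) → Walk G xs → Allᵛ P xs
Walk-all f (x ∷ y ∷ []) (g , _) = proj₁ (f x y g) ∷ proj₂ (f x y g) ∷ []
Walk-all f (x ∷ xs@(y ∷ _ ∷ _)) (g , w) = proj₁ (f x y g) ∷ Walk-all (λ a b h → proj₂ (f b a h) , proj₁ (f b a h)) xs w

Walk-linked : {K : Fin n → Fin n → Set} {G : Fin n → Fin n → Set} → (∀ a b → G a b → K a b × K b a) →
  (xs : Vec (Fin n) (suc l)) → Walk G xs → Linked K xs
Walk-linked f (x ∷ []) _ = [-]
Walk-linked f (x ∷ y ∷ xs) (g , w) = proj₁ (f x y g) ∷ Walk-linked (λ a b h → proj₂ (f b a h) , proj₁ (f b a h)) (y ∷ xs) w

-- After an even number of steps the walk is back on its starting side, where `f` applies to the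
-- edge just used; a walk without steps is covered by the hypothesis on `head xs`.
Walk-last : {P : Fin n → Set} {G : Fin n → Fin n → Set} → (∀ a b → G a b → P a) →
  ∀ t (xs : Vec (Fin n) (suc (t * 2))) → P (head xs) → Walk G xs → P (last xs)
Walk-last f zero (x ∷ []) p _ = p
Walk-last f (suc t) (x ∷ y ∷ z ∷ xs) p (_ , g , w) = Walk-last f t (z ∷ xs) (f z y g) w

-- Deleting the vertices of degree below K on one side costs at most K n edges, and a walk ending
-- at a surviving vertex can be prolonged in the undeleted graph.
long-walk : ∀ j K {G : Fin n → Fin n → Set} (G? : ∀ a b → Dec (G a b)) → (∀ a → ¬ G a a) →
  2 + j ≤ K → j * (K * n) < ∑ (λ a → # (G? a)) →
  ∃ λ (xs : Vec (Fin n) (2 + j)) → Uniqueᵛ xs × Walk G xs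
long-walk zero K {G} G? irr _ many with ∑-witness (λ a → # (G? a)) many
... | a , many′ with ∑-witness (λ b → ⟦ G? a b ⟧) many′
...   | b , pos = a ∷ b ∷ [] , ((λ { refl → irr a g }) ∷ []) ∷ [] ∷ [] , g , tt
  where
  g : G a b
  g = ⟦⟧-holds (G? a b) pos
long-walk {n} (suc j) K {G} G? irr 2+j<K many = extend (long-walk j K E′? (λ a → irr a ∘ proj₁) (<⇒≤ 2+j<K) many′)
  where
  open ≤-Reasoning
  E? : ∀ y a → Dec (G a y)
  E? y a = G? a y
  -- The two sides are exchanged, so a walk along `E′?` starts at some `y` with at least `K > 2 + j`
  -- neighbours; one of these is off the walk and can be put in front.
  E′? : ∀ y a → Dec (G a y × K ≤ # (E? y))
  E′? y a = E? y a ×-dec (K ≤? # (E? y))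
  prune : ∀ y → # (E? y) ≤ K + # (E′? y)
  prune y = go (K ≤? # (E? y))
    where
    go : Dec (K ≤ # (E? y)) → # (E? y) ≤ K + # (E′? y)
    go (yes K≤) = m≤n⇒m≤o+n K (#-mono (E? y) (E′? y) (λ a e → e , K≤))
    go (no K≰) = ≤-trans (<⇒≤ (≰⇒> K≰)) (m≤m+n K _)
  many′ : j * (K * n) < ∑ (λ y → # (E′? y))
  many′ = +-cancelˡ-< (K * n) _ _ (begin-strict
    K * n + j * (K * n)                     <⟨ many ⟩
    ∑ (λ a → # (G? a))                      ≡⟨ ∑-comm (λ a y → ⟦ G? a y ⟧) ⟩
    ∑ (λ y → # (E? y))                      ≤⟨ ∑-mono prune ⟩
    ∑ (λ y → K + # (E′? y))                 ≡⟨ ∑-distrib-+ (λ _ → K) (λ y → # (E′? y)) ⟩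
    ∑ {n} (λ y → K) + ∑ (λ y → # (E′? y))   ≡⟨ cong (_+ ∑ (λ y → # (E′? y))) (trans (∑-const n K) (*-comm n K)) ⟩
    K * n + ∑ (λ y → # (E′? y)) ∎)
  extend : (∃ λ (xs : Vec (Fin n) (2 + j)) → Uniqueᵛ xs × Walk (λ y a → G a y × K ≤ # (E? y)) xs) →
    ∃ λ (xs : Vec (Fin n) (3 + j)) → Uniqueᵛ xs × Walk G xs
  extend (xs@(y ∷ a ∷ _) , u , w@((_ , K≤) , _)) with #-fresh (E? y) xs (<-≤-trans 2+j<K K≤)
  ... | a′ , e , fr = a′ ∷ xs , fr ∷ u , e , Walk-map (λ _ _ → proj₁) xs w

-- Interleaving two sequences.

interleave : {A : Set} → Vec A (suc l) → Vec A l → Vec A (suc (l * 2))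
interleave (a ∷ []) [] = a ∷ []
interleave (a ∷ as@(_ ∷ _)) (z ∷ zs) = a ∷ z ∷ interleave as zs

interleave-all : {A : Set} {P : A → Set} (as : Vec A (suc l)) (zs : Vec A l) →
  Allᵛ P as → Allᵛ P zs → Allᵛ P (interleave as zs)
interleave-all (a ∷ []) [] (p ∷ []) [] = p ∷ []
interleave-all (a ∷ as@(_ ∷ _)) (z ∷ zs) (p ∷ ps) (q ∷ qs) = p ∷ q ∷ interleave-all as zs ps qs

interleave-unique : {A : Set} (as : Vec A (suc l)) (zs : Vec A l) → Uniqueᵛ as → Uniqueᵛ zs →
  Allᵛ (λ a → Allᵛ (a ≢_) zs) as → Uniqueᵛ (interleave as zs)
interleave-unique (a ∷ []) [] _ _ _ = [] ∷ []
interleave-unique (a ∷ as@(_ ∷ _)) (z ∷ zs) (a≢ ∷ ua) (z≢ ∷ uz) ((a≢z ∷ a≢zs) ∷ as≢) =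
  (a≢z ∷ interleave-all as zs a≢ a≢zs) ∷
  interleave-all as zs (All.map (λ h → ≢-sym (All.head h)) as≢) z≢ ∷
  interleave-unique as zs ua uz (All.map All.tail as≢)

interleave-head : {A : Set} (as : Vec A (suc l)) (zs : Vec A l) → head (interleave as zs) ≡ head as
interleave-head (a ∷ []) [] = refl
interleave-head (a ∷ _ ∷ _) (z ∷ zs) = refl

interleave-last : {A : Set} {P : A → Set} (as : Vec A (suc l)) (zs : Vec A l) → Allᵛ P as → P (last (interleave as zs))
interleave-last (a ∷ []) [] (p ∷ []) = p
interleave-last {l = suc l} (a ∷ as@(_ ∷ _)) (z ∷ zs) (_ ∷ ps) with interleave as zs | interleave-last as zs ps
... | y ∷ ys | h = h

interleave-linked : {A : Set} {K : A → A → Set} (as : Vec A (suc l)) (zs : Vec A l) →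
  Allᵛ (λ z → Allᵛ (λ a → K a z × K z a) as) zs → Linked K (interleave as zs)
interleave-linked (a ∷ []) [] _ = [-]
interleave-linked {K = K} (a ∷ as@(_ ∷ _)) (z ∷ zs) (h ∷ hs) =
  proj₁ (All.head h) ∷
  subst (K z) (sym (interleave-head as zs)) (proj₂ (All.head (All.tail h))) ∷
  interleave-linked as zs (All.map All.tail hs)

-- Small sets and alternating cycles.

List-lookup-injective : {A : Set} {xs : List A} → Unique xs →
  ∀ i j → List.lookup xs i ≡ List.lookup xs j → i ≡ j
List-lookup-injective (x≢ ∷ᵃ u) zero zero eq = refl
List-lookup-injective {xs = x ∷ xs} (x≢ ∷ᵃ u) zero (suc j) eq = contradiction eq (ListAll.lookup x≢ (∈-lookup {xs = xs} j))
List-lookup-injective {xs = x ∷ xs} (x≢ ∷ᵃ u) (suc i) zero eq = contradiction (sym eq) (ListAll.lookup x≢ (∈-lookup {xs = xs} i))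
List-lookup-injective (x≢ ∷ᵃ u) (suc i) (suc j) eq = cong suc (List-lookup-injective u i j eq)

smaller-⊂ : {A F : Subset n} → A ⊆ F → ∣ A ∣ < ∣ F ∣ → A ⊂ F
smaller-⊂ {A = A} {F} A⊆F lt with any? (λ x → (x ∈? F) ×-dec ¬? (x ∈? A))
... | yes (x , x∈F , x∉A) = A⊆F , x , x∈F , x∉A
... | no none = contradiction lt (≤⇒≯ (p⊆q⇒∣p∣≤∣q∣ λ {x} x∈F → decidable-stable (x ∈? A) λ x∉A → none (x , x∈F , x∉A)))

three-elements : {A : Subset n} (a x y : Fin n) → (∀ {z} → z ∈ A → z ≡ a ⊎ z ≡ x ⊎ z ≡ y) → ∣ A ∣ ≤ 3
three-elements {n} {A} a x y cover = begin
  ∣ A ∣                                                   ≡⟨ ∣∣≡# A ⟩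
  # (_∈? A)                                               ≤⟨ ∑-mono (λ z → ⟦⟧-≤ (z ∈? A) (hit z ∘ cover)) ⟩
  ∑ (λ z → ⟦ z ≟ a ⟧ + (⟦ z ≟ x ⟧ + ⟦ z ≟ y ⟧))           ≡⟨ trans (∑-distrib-+ (λ z → ⟦ z ≟ a ⟧) _) (cong (# (_≟ a) +_) (∑-distrib-+ (λ z → ⟦ z ≟ x ⟧) _)) ⟩
  # (_≟ a) + (# (_≟ x) + # (_≟ y))                        ≤⟨ +-mono-≤ (#≡ a) (+-mono-≤ (#≡ x) (#≡ y)) ⟩
  3 ∎
  where
  open ≤-Reasoning
  hit : ∀ z → z ≡ a ⊎ z ≡ x ⊎ z ≡ y → 1 ≤ ⟦ z ≟ a ⟧ + (⟦ z ≟ x ⟧ + ⟦ z ≟ y ⟧)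
  hit z (inj₁ e) = ≤-trans (≤-reflexive (sym (⟦⟧-yes (z ≟ a) e))) (m≤m+n _ _)
  hit z (inj₂ (inj₁ e)) = m≤n⇒m≤o+n ⟦ z ≟ a ⟧ (≤-trans (≤-reflexive (sym (⟦⟧-yes (z ≟ x) e))) (m≤m+n _ _))
  hit z (inj₂ (inj₂ e)) = m≤n⇒m≤o+n ⟦ z ≟ a ⟧ (m≤n⇒m≤o+n ⟦ z ≟ x ⟧ (≤-reflexive (sym (⟦⟧-yes (z ≟ y) e))))

-- The closed walk itself is a kernel cycle of length 2t + 4; replacing x e y by the kernel
-- triple {e, x, y} shortens it to 2t + 3.
alternating-cycle : ∀ {k m t} {𝓕 : Family n} → 1 ≤ k → (∀ F → F ∈ˡ 𝓕 → ∣ F ∣ ≡ k) →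
  m ≡ 2 + t * 2 ⊎ m ≡ 3 + t * 2 → ∀ x e y (zs : Vec (Fin n) (suc (t * 2))) → Uniqueᵛ (x ∷ e ∷ y ∷ zs) →
  InKer (k * suc m) 𝓕 (⁅ e ⁆ ∪ (⁅ x ⁆ ∪ ⁅ y ⁆)) →
  Linked (Kernel-pair (k * suc m) 𝓕) (x ∷ e ∷ y ∷ zs) →
  Kernel-pair (k * suc m) 𝓕 (last (y ∷ zs)) x → ContainsCycle m 𝓕
alternating-cycle 1≤k uniform (inj₁ refl) x e y zs u triple (_ ∷ _ ∷ ks) close =
  shortcut-cycle 1≤k uniform x e y zs u triple ks close
alternating-cycle 1≤k uniform (inj₂ refl) x e y zs u triple ks close =
  graph-cycle 1≤k uniform (x ∷ e ∷ y ∷ zs) u ks close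

-- Bounds independent of `n` and of the family.

-- The factor `j * K` lost in `long-walk` for `j = 2t + 1` and `K = 2t + 3`.
linkBound : ℕ → ℕ
linkBound t = suc (t * 2) * (3 + t * 2)

-- The weights add up to at most `linkBound t * n²`, and a hub has weight at least `n² / d²`.
hubBound : ℕ → ℕ → ℕ
hubBound t d = d * d * linkBound t

-- There are at most `hubBound t d ^ (2 + t)` tuples of `t + 2` hubs, each responsible for at most
-- `t + 2` poor vertices.
povertyBound : ℕ → ℕ → ℕ
povertyBound t d = (2 + t) * hubBound t d ^ (2 + t)

-- Kernel sets from centers and leaves.

-- Here t + 1 is the t of the paper, so that a cycle has length 2t + 3 or 2t + 4.
module CenteredFamily {n k m t q : ℕ} (k≡4+q : k ≡ 4 + q) (parity : m ≡ 2 + t * 2 ⊎ m ≡ 3 + t * 2)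
  (𝓕 : Family n) (unique : Unique 𝓕) (uniform : ∀ F → F ∈ˡ 𝓕 → ∣ F ∣ ≡ k)
  (centralized : Centralized (k * suc m) 𝓕) (cycle-free : ¬ ContainsCycle m 𝓕) where

  4≤k : 4 ≤ k
  4≤k = subst (4 ≤_) (sym k≡4+q) (m≤m+n 4 q)

  Kernel : Subset n → Set
  Kernel = InKer (k * suc m) 𝓕

  Kernel₂ : Fin n → Fin n → Set
  Kernel₂ = Kernel-pair (k * suc m) 𝓕

  member : Fin (length 𝓕) → Subset n
  member = List.lookup 𝓕

  member∈ : ∀ i → member i ∈ˡ 𝓕
  member∈ i = ∈-lookup i

  center : Fin (length 𝓕) → Fin n
  center i = proj₁ (centralized (member i) (member∈ i))

  center∈ : ∀ i → center i ∈ member i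
  center∈ i = proj₁ (proj₂ (centralized (member i) (member∈ i)))

  center-kernel : ∀ i A → A ⊂ member i → center i ∈ A → Kernel A
  center-kernel i = proj₂ (proj₂ (centralized (member i) (member∈ i)))

  Leaf : Fin (length 𝓕) → Fin n → Set
  Leaf i x = x ∈ member i × x ≢ center i

  leaf? : ∀ i → Decidable (Leaf i)
  leaf? i x = (x ∈? member i) ×-dec ¬? (x ≟ center i)

  _⟶_ : Fin n → Fin n → Set
  a ⟶ x = ∃ λ i → center i ≡ a × Leaf i x

  _⟶?_ : ∀ a x → Dec (a ⟶ x)
  a ⟶? x = any? λ i → (center i ≟ a) ×-dec leaf? i x

  R : Fin n → Fin n → Fin n → Set
  R a x y = ∃ λ i → center i ≡ a × Leaf i x × Leaf i y × x ≢ y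

  R? : ∀ a x y → Dec (R a x y)
  R? a x y = any? λ i → (center i ≟ a) ×-dec leaf? i x ×-dec leaf? i y ×-dec ¬? (x ≟ y)

  R⇒⟶ˡ : ∀ {a x y} → R a x y → a ⟶ x
  R⇒⟶ˡ (i , c , x , _) = i , c , x

  R⇒⟶ʳ : ∀ {a x y} → R a x y → a ⟶ y
  R⇒⟶ʳ (i , c , _ , y , _) = i , c , y

  ⟶-irrefl : ∀ {a x} → a ⟶ x → a ≢ x
  ⟶-irrefl (i , refl , _ , x≢a) a≡x = x≢a (sym a≡x)

  -- Since `k ≥ 4`, at most three vertices of a member form a proper subset, to which centralization
  -- applies.
  small-kernel : ∀ i {A} x y → Leaf i x → Leaf i y → center i ∈ A →
    (∀ {z} → z ∈ A → z ≡ center i ⊎ z ≡ x ⊎ z ≡ y) → Kernel A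
  small-kernel i {A} x y (x∈ , _) (y∈ , _) c∈A cover = center-kernel i A
    (smaller-⊂ (λ z∈ → contained (cover z∈))
      (<-≤-trans (s≤s (three-elements (center i) x y cover)) (≤-trans 4≤k (≤-reflexive (sym (uniform _ (member∈ i)))))))
    c∈A
    where
    contained : ∀ {z} → z ≡ center i ⊎ z ≡ x ⊎ z ≡ y → z ∈ member i
    contained (inj₁ refl) = center∈ i
    contained (inj₂ (inj₁ refl)) = x∈
    contained (inj₂ (inj₂ refl)) = y∈

  ⟶⇒Kernel₂ : ∀ {a x} → a ⟶ x → Kernel₂ a x
  ⟶⇒Kernel₂ {a} {x} (i , refl , leaf) = small-kernel i x x leaf leaf (pair-∈ˡ _ _) (⊎-map₂ inj₁ ∘ ∈-pair)

  Kernel₂-sym : ∀ {x y} → Kernel₂ x y → Kernel₂ y x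
  Kernel₂-sym {x} {y} = subst Kernel (∪-comm ⁅ x ⁆ ⁅ y ⁆)

  ⟶⇒Kernel₂ʳ : ∀ {a x} → a ⟶ x → Kernel₂ x a
  ⟶⇒Kernel₂ʳ = Kernel₂-sym ∘ ⟶⇒Kernel₂

  R⇒Kernel : ∀ {a x y} → R a x y → Kernel (⁅ a ⁆ ∪ (⁅ x ⁆ ∪ ⁅ y ⁆))
  R⇒Kernel {a} {x} {y} (i , refl , lx , ly , _) = small-kernel i x y lx ly (x∈p∪q⁺ (inj₁ (x∈⁅x⁆ a)))
    λ z∈ → ⊎-map (x∈⁅y⁆⇒x≡y a) ∈-pair (x∈p∪q⁻ _ _ z∈)

  -- The single relation `R e x y` supplies both the kernel triple and the kernel pairs at `e`, so
  -- either parity of the cycle length leads to a contradiction.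
  no-alternating-cycle : ∀ x e y (zs : Vec (Fin n) (suc (t * 2))) → Uniqueᵛ (x ∷ e ∷ y ∷ zs) →
    R e x y → Linked Kernel₂ (y ∷ zs) → Kernel₂ (last (y ∷ zs)) x → ⊥
  no-alternating-cycle x e y zs u r ks close = cycle-free (alternating-cycle {t = t} (≤-trans (s≤s z≤n) 4≤k) uniform parity
    x e y zs u (R⇒Kernel r) (⟶⇒Kernel₂ʳ (R⇒⟶ˡ r) ∷ ⟶⇒Kernel₂ (R⇒⟶ʳ r) ∷ ks) close)

  -- Sparsity of links.

  link-bound : ℕ
  link-bound = linkBound t

  -- A long walk in the link of w starts and ends at neighbours of w, hence closes up through w.
  link-sparse : ∀ w → ∑ (λ a → # (R? a w)) ≤ link-bound * n
  link-sparse w = ≮⇒≥ λ many → close-up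
    (long-walk (suc (t * 2)) (3 + t * 2) (λ a y → R? a w y) irr ≤-refl (subst (_< ∑ (λ a → # (R? a w))) (*-assoc (suc (t * 2)) (3 + t * 2) n) many))
    where
    irr : ∀ a → ¬ R a w a
    irr a r = ⟶-irrefl (R⇒⟶ʳ r) refl
    close-up : (∃ λ (xs : Vec (Fin n) (3 + t * 2)) → Uniqueᵛ xs × Walk (λ a y → R a w y) xs) → ⊥
    close-up (a ∷ y ∷ zs , u , walk@(r , walk′)) = no-alternating-cycle w a y zs
      (Walk-all off (a ∷ y ∷ zs) walk ∷ u) r
      (Walk-linked (λ b y r → ⟶⇒Kernel₂ʳ (R⇒⟶ʳ r) , ⟶⇒Kernel₂ (R⇒⟶ʳ r)) (y ∷ zs) walk′)
      -- The path has `2t + 2` steps, so its last vertex is again on the side of the centers and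
      -- points to `w`.
      (⟶⇒Kernel₂ (Walk-last (λ a y → R⇒⟶ˡ) (suc t) (a ∷ y ∷ zs) (R⇒⟶ˡ r) walk))
      where
      off : ∀ a y → R a w y → w ≢ a × w ≢ y
      off a y r@(_ , _ , _ , _ , w≢y) = ≢-sym (⟶-irrefl (R⇒⟶ˡ r)) , w≢y

  -- Joint in-neighbours of two vertices.

  common? : ∀ {l} (as : Vec (Fin n) l) → Decidable (λ z → Allᵛ (_⟶ z) as)
  common? as z = All.all? (_⟶? z) as

  joint? : {L : Fin n → Set} → Decidable L → ∀ x y → Decidable (λ a → L a × a ⟶ x × a ⟶ y)
  joint? L? x y a = L? a ×-dec (a ⟶? x) ×-dec (a ⟶? y)

  -- Otherwise `t + 1` joint in-neighbours other than `a` exist. Interleaved with `t` common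
  -- out-neighbours they lead from `y` back to `x`, and the path `x`, `a`, `y` completes an
  -- alternating closed walk on `2t + 4` vertices.
  few-joint-neighbours : {L : Fin n → Set} (L? : Decidable L) (a x y : Fin n) → L a → R a x y →
    (∀ (as : Vec (Fin n) (2 + t)) → Allᵛ L as → Allᵛ (_⟶ x) as → 2 + t ≤ # (common? as)) →
    # (joint? L? x y) ≤ suc t
  few-joint-neighbours {L} L? a x y La r rich = ≮⇒≥ λ many →
    let as , uas , as-joint = #-select others? (s≤s⁻¹ (≤-trans many (#-delete (joint? L? x y) a)))
        all-L = La ∷ All.map (proj₁ ∘ proj₁) as-joint
        all-x = R⇒⟶ˡ r ∷ All.map (proj₁ ∘ proj₂ ∘ proj₁) as-joint
        -- Of `t + 2` common out-neighbours at most two are `x` and `y`, which leaves `t`.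
        zs , uzs , zs-common = #-select (free? (a ∷ as)) (s≤s⁻¹ (s≤s⁻¹ (≤-trans (rich (a ∷ as) all-L all-x)
          (≤-trans (#-delete (common? (a ∷ as)) x) (s≤s (#-delete (λ z → common? (a ∷ as) z ×-dec ¬? (z ≟ x)) y))))))
    in close-up as zs uas uzs as-joint zs-common
    where
    others? : Decidable (λ b → (L b × b ⟶ x × b ⟶ y) × b ≢ a)
    others? b = joint? L? x y b ×-dec ¬? (b ≟ a)
    free? : ∀ {l} (as : Vec (Fin n) l) → Decidable (λ z → (Allᵛ (_⟶ z) as × z ≢ x) × z ≢ y)
    free? as z = (common? as z ×-dec ¬? (z ≟ x)) ×-dec ¬? (z ≟ y)
    close-up : (as : Vec (Fin n) (suc t)) (zs : Vec (Fin n) t) → Uniqueᵛ as → Uniqueᵛ zs →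
      Allᵛ (λ b → (L b × b ⟶ x × b ⟶ y) × b ≢ a) as →
      Allᵛ (λ z → (Allᵛ (_⟶ z) (a ∷ as) × z ≢ x) × z ≢ y) zs → ⊥
    close-up as zs uas uzs hs gs = no-alternating-cycle x a y (interleave as zs)
      ( (≢-sym (⟶-irrefl (R⇒⟶ˡ r)) ∷ x≢y r ∷ interleave-all as zs
          (All.map (λ ((_ , b⟶x , _) , _) x≡b → ⟶-irrefl b⟶x (sym x≡b)) hs)
          (All.map (λ ((_ , z≢x) , _) → ≢-sym z≢x) gs))
      ∷ (⟶-irrefl (R⇒⟶ʳ r) ∷ interleave-all as zs
          (All.map (λ (_ , b≢a) → ≢-sym b≢a) hs)
          (All.map (λ ((as⟶z , _) , _) → ⟶-irrefl (All.head as⟶z)) gs))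
      ∷ interleave-all as zs
          (All.map (λ ((_ , _ , b⟶y) , _) y≡b → ⟶-irrefl b⟶y (sym y≡b)) hs)
          (All.map (λ (_ , z≢y) → ≢-sym z≢y) gs)
      ∷ interleave-unique as zs uas uzs apart)
      r
      (first as zs hs ∷ interleave-linked as zs
        (All.map (λ ((as⟶z , _) , _) → All.map (λ b⟶z → ⟶⇒Kernel₂ b⟶z , ⟶⇒Kernel₂ʳ b⟶z) (All.tail as⟶z)) gs))
      (last-step (interleave as zs) (interleave-last as zs (All.map (λ ((_ , b⟶x , _) , _) → b⟶x) hs)))
      where
      x≢y : R a x y → x ≢ y
      x≢y (_ , _ , _ , _ , ne) = ne
      apart : Allᵛ (λ b → Allᵛ (b ≢_) zs) as
      apart = AllP.lookup⁻ λ i → AllP.lookup⁻ λ j →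
        ⟶-irrefl (AllP.lookup⁺ (All.tail (proj₁ (proj₁ (AllP.lookup⁺ gs j)))) i)
      first : (as : Vec (Fin n) (suc t)) (zs : Vec (Fin n) t) → Allᵛ (λ b → (L b × b ⟶ x × b ⟶ y) × b ≢ a) as →
        Kernel₂ y (head (interleave as zs))
      first as@(b ∷ _) zs (((_ , _ , b⟶y) , _) ∷ _) = subst (Kernel₂ y) (sym (interleave-head as zs)) (⟶⇒Kernel₂ʳ b⟶y)
      last-step : ∀ {l} (ws : Vec (Fin n) (suc l)) → last ws ⟶ x → Kernel₂ (last (y ∷ ws)) x
      last-step (_ ∷ _) h = ⟶⇒Kernel₂ h

  -- Ordered tuples of leaves.

  -- For length `3 + q = k - 1` the tuple lists a whole member except its center, so `a` and `p`
  -- determine the member.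
  E : ∀ {l} → Fin n → Vec (Fin n) l → Set
  E a p = ∃ λ i → center i ≡ a × Uniqueᵛ p × Allᵛ (Leaf i) p

  at? : ∀ {l} i a (p : Vec (Fin n) l) → Dec (center i ≡ a × Uniqueᵛ p × Allᵛ (Leaf i) p)
  at? i a p = (center i ≟ a) ×-dec arrangement? (leaf? i) p

  E? : ∀ {l} a (p : Vec (Fin n) l) → Dec (E a p)
  E? a p = any? λ i → at? i a p

  E⇒⟶ : ∀ {l a z} {p : Vec (Fin n) l} → E a (z ∷ p) → a ⟶ z
  E⇒⟶ (i , c , _ , lz ∷ _) = i , c , lz

  E⇒R : ∀ {l a z x y} {p : Vec (Fin n) l} → E a (z ∷ x ∷ y ∷ p) → R a z x × R a z y × R a x y
  E⇒R (i , c , (z≢x ∷ z≢y ∷ _) ∷ (x≢y ∷ _) ∷ _ , lz ∷ lx ∷ ly ∷ _) =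
    (i , c , lz , lx , z≢x) , (i , c , lz , ly , z≢y) , (i , c , lx , ly , x≢y)

  -- Otherwise the center, `x` and the `k - 1` entries of `p` would be `k + 1` elements of a
  -- `k`-set.
  leaf-listed : ∀ i (p : Vec (Fin n) (3 + q)) → Uniqueᵛ p → Allᵛ (Leaf i) p → ∀ {x} → Leaf i x → ∃ λ j → x ≡ lookup p j
  leaf-listed i p u ls {x} (x∈ , x≢c) with any? (λ j → x ≟ lookup p j)
  ... | yes found = found
  ... | no missing = contradiction (begin
    5 + q                  ≤⟨ #-unique (_∈? member i) (center i ∷ x ∷ p)
                               ((≢-sym x≢c ∷ All.map (≢-sym ∘ proj₂) ls) ∷ AllP.lookup⁻ (λ j eq → missing (j , eq)) ∷ u)
                               (center∈ i ∷ x∈ ∷ All.map proj₁ ls) ⟩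
    # (_∈? member i)       ≡⟨ ∣∣≡# (member i) ⟨
    ∣ member i ∣           ≡⟨ trans (uniform _ (member∈ i)) k≡4+q ⟩
    4 + q ∎) 1+n≰n
    where open ≤-Reasoning

  same-member : ∀ {i j} (p : Vec (Fin n) (3 + q)) → center i ≡ center j → Uniqueᵛ p → Allᵛ (Leaf i) p → Allᵛ (Leaf j) p →
    member i ⊆ member j
  same-member {i} {j} p c≡ u li lj {x} x∈ with x ≟ center i
  ... | yes refl = subst (_∈ member j) (sym c≡) (center∈ j)
  ... | no x≢c with leaf-listed i p u li (x∈ , x≢c)
  ...   | r , refl = proj₁ (AllP.lookup⁺ lj r)

  -- The `k - 1` leaves of a member can be ordered in `(k - 1)!` ways, and no pair of center and
  -- tuple comes from two members.
  ordered-count : (3 + q) ! * length 𝓕 ≤ ∑ (λ a → ∑ᵛ (3 + q) λ p → ⟦ E? a p ⟧)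
  ordered-count = begin
    (3 + q) ! * length 𝓕                                            ≡⟨ *-comm ((3 + q) !) (length 𝓕) ⟩
    length 𝓕 * (3 + q) !                                            ≡⟨ ∑-const (length 𝓕) ((3 + q) !) ⟨
    ∑ {length 𝓕} (λ i → (3 + q) !)                                  ≤⟨ ∑-mono (λ i → #-arrangements (3 + q) (leaf? i) (leaves i)) ⟩
    ∑ (λ i → ∑ᵛ (3 + q) λ p → ⟦ arrangement? (leaf? i) p ⟧)          ≤⟨ ∑-mono (λ i → ∑ᵛ-mono (3 + q) (own i)) ⟩
    ∑ (λ i → ∑ᵛ (3 + q) λ p → ∑ λ a → ⟦ at? i a p ⟧)                 ≡⟨ ∑-∑ᵛ-comm (3 + q) (λ i p → ∑ λ a → ⟦ at? i a p ⟧) ⟩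
    ∑ᵛ (3 + q) (λ p → ∑ λ i → ∑ λ a → ⟦ at? i a p ⟧)                 ≤⟨ ∑ᵛ-mono (3 + q) (λ p → ≤-trans (≤-reflexive (∑-comm (λ i a → ⟦ at? i a p ⟧))) (∑-mono (once p))) ⟩
    ∑ᵛ (3 + q) (λ p → ∑ λ a → ⟦ E? a p ⟧)                            ≡⟨ ∑-∑ᵛ-comm (3 + q) (λ a p → ⟦ E? a p ⟧) ⟨
    ∑ (λ a → ∑ᵛ (3 + q) λ p → ⟦ E? a p ⟧) ∎
    where
    open ≤-Reasoning
    leaves : ∀ i → 3 + q ≤ # (leaf? i)
    leaves i = s≤s⁻¹ (begin
      4 + q                ≡⟨ trans (uniform _ (member∈ i)) k≡4+q ⟨
      ∣ member i ∣         ≡⟨ ∣∣≡# (member i) ⟩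
      # (_∈? member i)     ≤⟨ #-delete (_∈? member i) (center i) ⟩
      suc (# (leaf? i)) ∎)
    own : ∀ i (p : Vec (Fin n) (3 + q)) → ⟦ arrangement? (leaf? i) p ⟧ ≤ ∑ λ a → ⟦ at? i a p ⟧
    own i p = ≤-trans (⟦⟧-mono (arrangement? (leaf? i) p) (at? i (center i) p) (λ h → refl , h))
      (term≤∑ (λ a → ⟦ at? i a p ⟧) (center i))
    once : ∀ p a → ∑ (λ i → ⟦ at? i a p ⟧) ≤ ⟦ E? a p ⟧
    once p a = #≤⟦⟧ (λ i → at? i a p) (E? a p) (λ i h → i , h) λ { _ i j (ci , u , li) (cj , _ , lj) →
      List-lookup-injective unique i j (⊆-antisym
        (same-member {i} {j} p (trans ci (sym cj)) u li lj) (same-member {j} {i} p (trans cj (sym ci)) u lj li)) }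

  -- Weights of centers.

  degree : Fin n → Fin n → ℕ
  degree a w = # (R? a w)

  weight : Fin n → ℕ
  weight a = ∑ (degree a)

  total-weight : ∑ weight ≤ n * (link-bound * n)
  total-weight = ≤-trans (≤-reflexive (∑-comm degree)) (∑-bound link-sparse)

  tuples : Fin n → ℕ
  tuples a = ∑ᵛ (3 + q) λ p → ⟦ E? a p ⟧

  -- An edge (z, x, y) of the link of a is charged to the pairs zx, zy if z has small degree, and otherwise
  -- to z and the pair xy: there are few vertices z of large degree.
  light-center : ∀ d a .{{_ : NonZero n}} → d * d * weight a ≤ n * n → d * tuples a ≤ 2 * (n * weight a) * n ^ q
  light-center d a light = begin
    d * tuples a                                                        ≤⟨ *-monoʳ-≤ d (∑-mono (λ z → ∑-mono (λ x → ∑-mono (λ y → ∑ᵛ-mono q (charge z x y))))) ⟩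
    d * ∑ (λ z → ∑ λ x → ∑ λ y → ∑ᵛ {n} q λ _ → near z x y + far z x y)   ≡⟨ cong (d *_) (∑-cong λ z → trans (∑-cong λ x → trans (∑-cong λ y → ∑ᵛ-const q (near z x y + far z x y)) (sym (*-∑ (n ^ q) _))) (sym (*-∑ (n ^ q) _))) ⟩
    d * ∑ (λ z → n ^ q * ∑ λ x → ∑ λ y → near z x y + far z x y)          ≡⟨ cong (d *_) (*-∑ (n ^ q) _) ⟨
    d * (n ^ q * ∑ (λ z → ∑ λ x → ∑ λ y → near z x y + far z x y))        ≡⟨ cong (λ w → d * (n ^ q * w)) (trans (∑-cong separate) (∑-distrib-+ _ (λ z → ⟦ heavy? z ⟧ * weight a))) ⟩
    d * (n ^ q * (∑ (λ z → ⟦ small? z ⟧ * (degree a z * degree a z)) + ∑ (λ z → ⟦ heavy? z ⟧ * weight a))) ≡⟨ regroup d (n ^ q) _ _ ⟩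
    (d * ∑ (λ z → ⟦ small? z ⟧ * (degree a z * degree a z)) + d * ∑ (λ z → ⟦ heavy? z ⟧ * weight a)) * n ^ q ≤⟨ *-monoˡ-≤ (n ^ q) (+-mono-≤ near-bound far-bound) ⟩
    (n * weight a + n * weight a) * n ^ q                               ≡⟨ cong (_* n ^ q) (cong (n * weight a +_) (+-identityʳ (n * weight a))) ⟨
    2 * (n * weight a) * n ^ q ∎
    where
    open ≤-Reasoning
    regroup : ∀ d p u v → d * (p * (u + v)) ≡ (d * u + d * v) * p
    regroup = solve-∀
    heavy? : ∀ z → Dec (n < d * degree a z)
    heavy? z = n <? d * degree a z
    small? : ∀ z → Dec (¬ n < d * degree a z)
    small? z = ¬? (heavy? z)
    near far : Fin n → Fin n → Fin n → ℕ
    near z x y = ⟦ small? z ⟧ * (⟦ R? a z x ⟧ * ⟦ R? a z y ⟧)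
    far z x y = ⟦ heavy? z ⟧ * ⟦ R? a x y ⟧
    charge : ∀ z x y (p : Vec (Fin n) q) → ⟦ E? a (z ∷ x ∷ y ∷ p) ⟧ ≤ near z x y + far z x y
    charge z x y p = ⟦⟧-≤ (E? a (z ∷ x ∷ y ∷ p)) λ e → pay (E⇒R e) (heavy? z)
      where
      pay : R a z x × R a z y × R a x y → (h : Dec (n < d * degree a z)) →
        1 ≤ ⟦ ¬? h ⟧ * (⟦ R? a z x ⟧ * ⟦ R? a z y ⟧) + ⟦ h ⟧ * ⟦ R? a x y ⟧
      pay (zx , zy , xy) (yes h) = m≤n⇒m≤o+n _ (≤-reflexive (sym (cong₂ _*_ (⟦⟧-yes (yes h) h) (⟦⟧-yes (R? a x y) xy))))
      pay (zx , zy , xy) (no h) = m≤n⇒m≤n+o _ (≤-reflexive (sym (cong₂ _*_ (⟦⟧-yes (¬? (no h)) h)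
        (cong₂ _*_ (⟦⟧-yes (R? a z x) zx) (⟦⟧-yes (R? a z y) zy)))))
    separate : ∀ z → ∑ (λ x → ∑ λ y → near z x y + far z x y) ≡
      ⟦ small? z ⟧ * (degree a z * degree a z) + ⟦ heavy? z ⟧ * weight a
    separate z = begin-equality
      ∑ (λ x → ∑ λ y → near z x y + far z x y)                   ≡⟨ ∑-cong (λ x → ∑-distrib-+ (near z x) (far z x)) ⟩
      ∑ (λ x → ∑ (near z x) + ∑ (far z x))                       ≡⟨ ∑-distrib-+ (λ x → ∑ (near z x)) (λ x → ∑ (far z x)) ⟩
      ∑ (λ x → ∑ (near z x)) + ∑ (λ x → ∑ (far z x))             ≡⟨ cong₂ _+_
        (trans (∑-cong λ x → trans (sym (*-∑ ⟦ small? z ⟧ _)) (cong (⟦ small? z ⟧ *_) (trans (sym (*-∑ ⟦ R? a z x ⟧ _)) (*-comm ⟦ R? a z x ⟧ (degree a z)))))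
          (trans (sym (*-∑ ⟦ small? z ⟧ _)) (cong (⟦ small? z ⟧ *_) (sym (*-∑ (degree a z) _)))))
        (trans (∑-cong λ x → sym (*-∑ ⟦ heavy? z ⟧ _)) (sym (*-∑ ⟦ heavy? z ⟧ _))) ⟩
      ⟦ small? z ⟧ * (degree a z * degree a z) + ⟦ heavy? z ⟧ * weight a ∎
    near-bound : d * ∑ (λ z → ⟦ small? z ⟧ * (degree a z * degree a z)) ≤ n * weight a
    near-bound = begin
      d * ∑ (λ z → ⟦ small? z ⟧ * (degree a z * degree a z))     ≡⟨ *-∑ d _ ⟩
      ∑ (λ z → d * (⟦ small? z ⟧ * (degree a z * degree a z)))   ≤⟨ ∑-mono (λ z → ≤-trans (≤-reflexive (swap d ⟦ small? z ⟧ (degree a z)))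
                                                                      (⟦⟧*-≤ (small? z) λ h → *-monoˡ-≤ (degree a z) (≮⇒≥ h))) ⟩
      ∑ (λ z → n * degree a z)                                   ≡⟨ *-∑ n (degree a) ⟨
      n * weight a ∎
      where
      swap : ∀ d s r → d * (s * (r * r)) ≡ s * (d * r * r)
      swap = solve-∀
    -- A heavy vertex has degree above `n / d`, so there are at most `d * weight a / n` of them,
    -- which is at most `n / d` for a light center.
    few-heavy : d * # heavy? ≤ n
    few-heavy = *-cancelˡ-≤ n (begin
      n * (d * # heavy?)                     ≡⟨ swap n d (# heavy?) ⟩
      d * (n * # heavy?)                     ≡⟨ cong (d *_) (*-∑ n _) ⟩
      d * ∑ (λ z → n * ⟦ heavy? z ⟧)         ≤⟨ *-monoʳ-≤ d (∑-mono (λ z → ≤-trans (≤-reflexive (*-comm n ⟦ heavy? z ⟧)) (⟦⟧*-≤ (heavy? z) <⇒≤))) ⟩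
      d * ∑ (λ z → d * degree a z)           ≡⟨ cong (d *_) (*-∑ d (degree a)) ⟨
      d * (d * weight a)                     ≡⟨ *-assoc d d (weight a) ⟨
      d * d * weight a                       ≤⟨ light ⟩
      n * n ∎)
      where
      swap : ∀ n d h → n * (d * h) ≡ d * (n * h)
      swap = solve-∀
    far-bound : d * ∑ (λ z → ⟦ heavy? z ⟧ * weight a) ≤ n * weight a
    far-bound = begin
      d * ∑ (λ z → ⟦ heavy? z ⟧ * weight a)  ≡⟨ cong (d *_) (trans (∑-cong λ z → *-comm ⟦ heavy? z ⟧ (weight a)) (sym (*-∑ (weight a) _))) ⟩
      d * (weight a * # heavy?)              ≡⟨ swap d (weight a) (# heavy?) ⟩
      d * # heavy? * weight a                ≤⟨ *-monoˡ-≤ (weight a) few-heavy ⟩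
      n * weight a ∎
      where
      swap : ∀ d w h → d * (w * h) ≡ d * h * w
      swap = solve-∀

  -- Hubs.

  module Threshold (d : ℕ) .{{_ : NonZero n}} where

    Hub : Fin n → Set
    Hub a = n * n ≤ d * d * weight a

    hub? : Decidable Hub
    hub? a = n * n ≤? d * d * weight a

    hub-bound : ℕ
    hub-bound = hubBound t d

    few-hubs : # hub? ≤ hub-bound
    few-hubs = *-cancelˡ-≤ (n * n) {{m*n≢0 n n}} (begin
      n * n * # hub?                    ≡⟨ *-∑ (n * n) _ ⟩
      ∑ (λ a → n * n * ⟦ hub? a ⟧)      ≤⟨ ∑-mono (λ a → ≤-trans (≤-reflexive (*-comm (n * n) ⟦ hub? a ⟧)) (⟦⟧*-≤ (hub? a) id)) ⟩
      ∑ (λ a → d * d * weight a)        ≡⟨ *-∑ (d * d) weight ⟨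
      d * d * ∑ weight                  ≤⟨ *-monoʳ-≤ (d * d) total-weight ⟩
      d * d * (n * (link-bound * n))    ≡⟨ regroup d n link-bound ⟩
      n * n * hub-bound ∎)
      where
      open ≤-Reasoning
      regroup : ∀ d n c → d * d * (n * (c * n)) ≡ n * n * (d * d * c)
      regroup = solve-∀

    nonhub-tuples : ℕ
    nonhub-tuples = ∑ λ a → ⟦ ¬? (hub? a) ⟧ * tuples a

    -- `light-center` keeps the factor `weight a`, so summing over the non-hubs costs only the total
    -- weight, of order `n²`; bounding each weight by `n² / d²` separately would lose a factor `n`.
    few-nonhub-tuples : d * nonhub-tuples ≤ 2 * link-bound * n ^ (3 + q)
    few-nonhub-tuples = begin
      d * nonhub-tuples                                ≡⟨ *-∑ d _ ⟩
      ∑ (λ a → d * (⟦ ¬? (hub? a) ⟧ * tuples a))       ≤⟨ ∑-mono (λ a → ≤-trans (≤-reflexive (swap d ⟦ ¬? (hub? a) ⟧ (tuples a)))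
                                                          (⟦⟧*-≤ (¬? (hub? a)) λ ¬h → light-center d a (<⇒≤ (≰⇒> ¬h)))) ⟩
      ∑ (λ a → 2 * (n * weight a) * n ^ q)             ≡⟨ trans (∑-cong (λ a → pull n (weight a) (n ^ q))) (sym (*-∑ (2 * n * n ^ q) weight)) ⟩
      2 * n * n ^ q * ∑ weight                         ≤⟨ *-monoʳ-≤ (2 * n * n ^ q) total-weight ⟩
      2 * n * n ^ q * (n * (link-bound * n))           ≡⟨ regroup n (n ^ q) link-bound ⟩
      2 * link-bound * n ^ (3 + q) ∎
      where
      open ≤-Reasoning
      swap : ∀ d h f → d * (h * f) ≡ h * (d * f)
      swap = solve-∀
      pull : ∀ n w p → 2 * (n * w) * p ≡ 2 * n * p * w
      pull = solve-∀
      regroup : ∀ n p c → 2 * n * p * (n * (c * n)) ≡ 2 * c * (n * (n * (n * p)))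
      regroup = solve-∀

    -- Poor vertices.

    -- `as` witnesses that `x` is exceptional: these `t + 2` hubs, repetitions allowed, point to `x`
    -- but have too few common out-neighbours for `few-joint-neighbours`.
    Poor : Fin n → Vec (Fin n) (2 + t) → Set
    Poor x as = Allᵛ Hub as × # (common? as) < 2 + t × Allᵛ (_⟶ x) as

    poor? : ∀ x as → Dec (Poor x as)
    poor? x as = All.all? hub? as ×-dec (# (common? as) <? 2 + t) ×-dec common? as x

    poverty : Fin n → ℕ
    poverty x = ∑ᵛ (2 + t) λ as → ⟦ poor? x as ⟧

    poverty-bound : ℕ
    poverty-bound = povertyBound t d

    -- Counted by tuples of hubs instead of by vertices: a tuple with fewer than `t + 2` common
    -- out-neighbours contributes for these only, so the bound does not grow with `n`.
    total-poverty : ∑ poverty ≤ poverty-bound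
    total-poverty = begin
      ∑ poverty                                                    ≡⟨ ∑-∑ᵛ-comm (2 + t) (λ x as → ⟦ poor? x as ⟧) ⟩
      ∑ᵛ (2 + t) (λ as → # (λ x → poor? x as))                     ≤⟨ ∑ᵛ-mono (2 + t) (λ as → per-tuple as (All.all? hub? as) (# (common? as) <? 2 + t)) ⟩
      ∑ᵛ (2 + t) (λ as → (2 + t) * ⟦ All.all? hub? as ⟧)           ≡⟨ *-∑ᵛ (2 + t) (2 + t) (λ as → ⟦ All.all? hub? as ⟧) ⟨
      (2 + t) * ∑ᵛ (2 + t) (λ as → ⟦ All.all? hub? as ⟧)           ≤⟨ *-monoʳ-≤ (2 + t) (∑ᵛ-all (2 + t) hub?) ⟩
      (2 + t) * # hub? ^ (2 + t)                                   ≤⟨ *-monoʳ-≤ (2 + t) (^-monoˡ-≤ (2 + t) few-hubs) ⟩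
      poverty-bound ∎
      where
      open ≤-Reasoning
      per-tuple : ∀ as (h : Dec (Allᵛ Hub as)) → Dec (# (common? as) < 2 + t) → # (λ x → poor? x as) ≤ (2 + t) * ⟦ h ⟧
      per-tuple as (yes h) (yes s) = begin
        # (λ x → poor? x as)   ≤⟨ #-mono (λ x → poor? x as) (common? as) (λ x → proj₂ ∘ proj₂) ⟩
        # (common? as)         ≤⟨ <⇒≤ s ⟩
        2 + t                  ≡⟨ *-identityʳ (2 + t) ⟨
        (2 + t) * 1            ≡⟨ cong ((2 + t) *_) (⟦⟧-yes (yes h) h) ⟨
        (2 + t) * ⟦ yes h ⟧ ∎
      per-tuple as h (no ¬s) = ≤-trans (∑-bound λ x → ≤-reflexive (⟦⟧-no (poor? x as) λ (_ , s , _) → ¬s s)) (≤-trans (≤-reflexive (*-zeroʳ n)) z≤n)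
      per-tuple as (no ¬h) _ = ≤-trans (∑-bound λ x → ≤-reflexive (⟦⟧-no (poor? x as) λ (h , _) → ¬h h)) (≤-trans (≤-reflexive (*-zeroʳ n)) z≤n)

    not-poor : ∀ x → poverty x ≡ 0 → (as : Vec (Fin n) (2 + t)) → Allᵛ Hub as → Allᵛ (_⟶ x) as → 2 + t ≤ # (common? as)
    not-poor x p≡0 as hs as⟶x = ≮⇒≥ λ s → ⟦⟧-fails (poor? x as)
      (n≤0⇒n≡0 (≤-trans (term≤∑ᵛ (2 + t) (λ as → ⟦ poor? x as ⟧) as) (≤-reflexive p≡0))) (hs , s , as⟶x)

    -- The gain of a tuple.

    hubs? : ∀ {l} (p : Vec (Fin n) l) → Decidable (λ a → Hub a × E a p)
    hubs? p a = hub? a ×-dec E? a p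

    -- The number of hubs from which the tuple arises, set to 0 for poor `x` so that `t + 1` bounds
    -- it for every tuple. The entry `z`, which is to vary while the others are fixed, is a separate
    -- argument.
    gain : Fin n → Vec (Fin n) (2 + q) → ℕ
    gain z (x ∷ p) = ⟦ poverty x ≟ℕ 0 ⟧ * # (hubs? (z ∷ x ∷ p))

    -- A tuple not counted by `gain` has a center that is no hub, or a poor second entry. In the
    -- latter case at most `hub-bound` hubs share it, and the entries other than `x` are free.
    total-gain : ∑ tuples ≤ ∑ᵛ (2 + q) (λ p → ∑ λ z → gain z p) + hub-bound * poverty-bound * n ^ (2 + q) + nonhub-tuples
    total-gain = begin
      ∑ tuples                                                                          ≤⟨ ∑-mono hub-or-not ⟩
      ∑ (λ a → ∑ᵛ (3 + q) (λ p → ⟦ hubs? p a ⟧) + ⟦ ¬? (hub? a) ⟧ * tuples a)           ≡⟨ ∑-distrib-+ _ (λ a → ⟦ ¬? (hub? a) ⟧ * tuples a) ⟩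
      ∑ (λ a → ∑ᵛ (3 + q) (λ p → ⟦ hubs? p a ⟧)) + nonhub-tuples                        ≡⟨ cong (_+ nonhub-tuples) (∑-∑ᵛ-comm (3 + q) (λ a p → ⟦ hubs? p a ⟧)) ⟩
      ∑ (λ z → ∑ᵛ (2 + q) λ p → # (hubs? (z ∷ p))) + nonhub-tuples                      ≤⟨ +-monoˡ-≤ nonhub-tuples (∑-mono (λ z → ∑ᵛ-mono (2 + q) (poor-or-not z))) ⟩
      ∑ (λ z → ∑ᵛ (2 + q) λ p → gain z p + hub-bound * poverty (head p)) + nonhub-tuples ≡⟨ cong (_+ nonhub-tuples) (trans (∑-cong λ z → ∑ᵛ-distrib-+ (2 + q) (gain z) (λ p → hub-bound * poverty (head p))) (∑-distrib-+ (λ z → ∑ᵛ (2 + q) (gain z)) _)) ⟩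
      ∑ (λ z → ∑ᵛ (2 + q) (gain z)) + ∑ {n} (λ z → ∑ᵛ (2 + q) λ p → hub-bound * poverty (head p)) + nonhub-tuples
        ≤⟨ +-monoˡ-≤ nonhub-tuples (+-mono-≤ (≤-reflexive (∑-∑ᵛ-comm (2 + q) gain)) poor-part) ⟩
      ∑ᵛ (2 + q) (λ p → ∑ λ z → gain z p) + hub-bound * poverty-bound * n ^ (2 + q) + nonhub-tuples ∎
      where
      open ≤-Reasoning
      hub-or-not : ∀ a → tuples a ≤ ∑ᵛ (3 + q) (λ p → ⟦ hubs? p a ⟧) + ⟦ ¬? (hub? a) ⟧ * tuples a
      hub-or-not a = go (hub? a)
        where
        go : Dec (Hub a) → tuples a ≤ ∑ᵛ (3 + q) (λ p → ⟦ hubs? p a ⟧) + ⟦ ¬? (hub? a) ⟧ * tuples a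
        go (yes h) = m≤n⇒m≤n+o _ (∑ᵛ-mono (3 + q) λ p → ⟦⟧-mono (E? a p) (hubs? p a) (h ,_))
        go (no ¬h) = m≤n⇒m≤o+n _ (≤-reflexive (sym (trans (cong (_* tuples a) (⟦⟧-yes (¬? (hub? a)) ¬h)) (*-identityˡ (tuples a)))))
      poor-or-not : ∀ z p → # (hubs? (z ∷ p)) ≤ gain z p + hub-bound * poverty (head p)
      poor-or-not z (x ∷ p) = go (poverty x) (poverty x ≟ℕ 0)
        where
        cnt : ℕ
        cnt = # (hubs? (z ∷ x ∷ p))
        go : ∀ b (e : Dec (b ≡ 0)) → cnt ≤ ⟦ e ⟧ * cnt + hub-bound * b
        go b (yes e) = m≤n⇒m≤n+o _ (≤-reflexive (sym (trans (cong (_* cnt) (⟦⟧-yes (yes e) e)) (*-identityˡ cnt))))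
        go zero (no b≢0) = contradiction refl b≢0
        -- A poor `x` has poverty at least 1, which pays for all hubs at once.
        go (suc b) (no _) = m≤n⇒m≤o+n _ (≤-trans (≤-trans (#-mono (hubs? (z ∷ x ∷ p)) hub? λ _ → proj₁) few-hubs) (m≤m*n hub-bound (suc b)))
      poor-part : ∑ {n} (λ z → ∑ᵛ (2 + q) λ p → hub-bound * poverty (head p)) ≤ hub-bound * poverty-bound * n ^ (2 + q)
      poor-part = begin
        ∑ {n} (λ z → ∑ λ x → ∑ᵛ {n} (1 + q) λ p → hub-bound * poverty x)    ≡⟨ ∑-const n _ ⟩
        n * ∑ (λ x → ∑ᵛ {n} (1 + q) λ p → hub-bound * poverty x)            ≡⟨ cong (n *_) (∑-cong λ x → trans (∑ᵛ-const (1 + q) (hub-bound * poverty x)) (sym (*-assoc (n ^ (1 + q)) hub-bound (poverty x)))) ⟩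
        n * ∑ (λ x → n ^ (1 + q) * hub-bound * poverty x)                   ≡⟨ cong (n *_) (*-∑ (n ^ (1 + q) * hub-bound) poverty) ⟨
        n * (n ^ (1 + q) * hub-bound * ∑ poverty)                           ≤⟨ *-monoʳ-≤ n (*-monoʳ-≤ (n ^ (1 + q) * hub-bound) total-poverty) ⟩
        n * (n ^ (1 + q) * hub-bound * poverty-bound)                       ≡⟨ regroup n (n ^ (1 + q)) hub-bound poverty-bound ⟩
        hub-bound * poverty-bound * n ^ (2 + q) ∎
        where
        regroup : ∀ n p h b → n * (p * h * b) ≡ h * b * (n * p)
        regroup = solve-∀

    hubs⇒joint : ∀ {l z x y} {p : Vec (Fin n) l} a → Hub a × E a (z ∷ x ∷ y ∷ p) → Hub a × a ⟶ x × a ⟶ y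
    hubs⇒joint a (h , e) = let _ , _ , r = E⇒R e in h , R⇒⟶ˡ r , R⇒⟶ʳ r

    hubs≤joint : ∀ z x y (p : Vec (Fin n) q) → # (hubs? (z ∷ x ∷ y ∷ p)) ≤ # (joint? hub? x y)
    hubs≤joint z x y p = #-mono (hubs? (z ∷ x ∷ y ∷ p)) (joint? hub? x y) (hubs⇒joint {z = z} {p = p})

    -- One hub giving rise to the tuple supplies the relation `R a x y` that `few-joint-neighbours`
    -- asks for.
    joint-bound : ∀ z x y (p : Vec (Fin n) q) → poverty x ≡ 0 → 0 < # (hubs? (z ∷ x ∷ y ∷ p)) → # (joint? hub? x y) ≤ suc t
    joint-bound z x y p rich pos =
      let a , pos′ = ∑-witness (λ a → ⟦ hubs? (z ∷ x ∷ y ∷ p) a ⟧) pos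
          h , e = ⟦⟧-holds (hubs? (z ∷ x ∷ y ∷ p) a) pos′
      in few-joint-neighbours hub? a x y h (proj₂ (proj₂ (E⇒R e))) (not-poor x rich)

    gain-bound : ∀ z p → gain z p ≤ suc t
    gain-bound z (x ∷ y ∷ p) = ⟦⟧*-≤ (poverty x ≟ℕ 0) λ rich → go rich (# (hubs? (z ∷ x ∷ y ∷ p))) refl
      where
      go : poverty x ≡ 0 → ∀ c → c ≡ # (hubs? (z ∷ x ∷ y ∷ p)) → c ≤ suc t
      go rich zero _ = z≤n
      go rich (suc c) eq = ≤-trans (≤-reflexive eq) (≤-trans (hubs≤joint z x y p)
        (joint-bound z x y p rich (subst (0 <_) eq z<s)))

    -- The `t + 1` hubs of the tuple are among the at most `t + 1` hubs pointing to `x` and `y`, so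
    -- the two sets agree. The latter set is the same for every `z`.
    full-gain : ∀ z x y (p : Vec (Fin n) q) → gain z (x ∷ y ∷ p) ≡ suc t →
      # (joint? hub? x y) ≡ suc t × (∀ a → Hub a × a ⟶ x × a ⟶ y → a ⟶ z)
    full-gain z x y p = go (poverty x ≟ℕ 0)
      where
      cnt : ℕ
      cnt = # (hubs? (z ∷ x ∷ y ∷ p))
      go : (e : Dec (poverty x ≡ 0)) → ⟦ e ⟧ * cnt ≡ suc t →
        # (joint? hub? x y) ≡ suc t × (∀ a → Hub a × a ⟶ x × a ⟶ y → a ⟶ z)
      go (no b≢0) full = contradiction (trans (sym full) (cong (_* cnt) (⟦⟧-no (no b≢0) b≢0))) 1+n≢0
      go (yes rich) full = ≤-antisym joint≤ (≤-trans (≤-reflexive (sym count)) (hubs≤joint z x y p)) ,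
        λ a j → E⇒⟶ (proj₂ (#-saturated (hubs? (z ∷ x ∷ y ∷ p)) (joint? hub? x y) (hubs⇒joint {z = z} {p = p})
          (≤-trans joint≤ (≤-reflexive (sym count))) a j))
        where
        count : cnt ≡ suc t
        count = trans (sym (trans (cong (_* cnt) (⟦⟧-yes (yes rich) rich)) (*-identityˡ cnt))) full
        joint≤ : # (joint? hub? x y) ≤ suc t
        joint≤ = joint-bound z x y p rich (subst (0 <_) (sym count) z<s)

    -- Averaging and the sets `S` and `T`.

    -- `T` misses at most `r ≤ n / e` vertices for a fixed `e`; the error `o(n)` arises later by
    -- letting `e` grow with `n`.
    Conclusion : ℕ → Set
    Conclusion e = Σ (Subset n) λ S → Σ (Subset n) λ T → ∃ λ r →
      (∀ x → x ∈ S → x ∉ T) × ∣ S ∣ ≡ suc t × n ≤ ∣ T ∣ + r × e * r ≤ n ×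
      (∀ a x → a ∈ S → x ∈ T → Kernel₂ a x)

    -- Every `z` whose gain is not the maximal `t + 1` loses at least 1 from the sum, so at most
    -- `n / e` values are short. All others lie in `T` by `full-gain`.
    extract : ∀ e → 2 ≤ e → (p : Vec (Fin n) (2 + q)) → suc t * e * n ≤ e * ∑ (λ z → gain z p) + n → Conclusion e
    extract e 2≤e p@(x ∷ y ∷ p′) large =
      ⟪ joint? hub? x y ⟫ , ⟪ T? ⟫ , # short? ,
      -- A vertex in both sets would point to itself.
      (λ a a∈S a∈T → ⟶-irrefl (∈⟪⟫⁻ T? a∈T a (∈⟪⟫⁻ (joint? hub? x y) a∈S)) refl) ,
      trans (∣⟪⟫∣ (joint? hub? x y)) (proj₁ (full-gain (proj₁ some-full) x y p′ (proj₂ some-full))) ,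
      covers ,
      few-short ,
      λ a z a∈S z∈T → ⟶⇒Kernel₂ (∈⟪⟫⁻ T? z∈T a (∈⟪⟫⁻ (joint? hub? x y) a∈S))
      where
      open ≤-Reasoning
      short? : Decidable (λ z → gain z p ≢ suc t)
      short? z = ¬? (gain z p ≟ℕ suc t)
      T? : Decidable (λ z → ∀ a → Hub a × a ⟶ x × a ⟶ y → a ⟶ z)
      T? z = all? λ a → joint? hub? x y a →-dec (a ⟶? z)
      loss : ∀ z → ⟦ short? z ⟧ + gain z p ≤ suc t
      loss z = go (gain z p ≟ℕ suc t)
        where
        go : (f : Dec (gain z p ≡ suc t)) → ⟦ ¬? f ⟧ + gain z p ≤ suc t
        go (yes f) = ≤-trans (≤-reflexive (cong (_+ gain z p) (⟦⟧-no (¬? (yes f)) λ h → h f))) (gain-bound z p)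
        go (no f) = ≤-trans (≤-reflexive (cong (_+ gain z p) (⟦⟧-yes (¬? (no f)) f))) (≤∧≢⇒< (gain-bound z p) f)
      few-short : e * # short? ≤ n
      few-short = +-cancelʳ-≤ (e * ∑ (λ z → gain z p)) (e * # short?) n (begin
        e * # short? + e * ∑ (λ z → gain z p)         ≡⟨ *-distribˡ-+ e (# short?) _ ⟨
        e * (# short? + ∑ (λ z → gain z p))           ≡⟨ cong (e *_) (∑-distrib-+ (λ z → ⟦ short? z ⟧) _) ⟨
        e * ∑ (λ z → ⟦ short? z ⟧ + gain z p)         ≤⟨ *-monoʳ-≤ e (∑-bound loss) ⟩
        e * (n * suc t)                               ≡⟨ regroup e n (suc t) ⟩
        suc t * e * n                                 ≤⟨ large ⟩
        e * ∑ (λ z → gain z p) + n                    ≡⟨ +-comm _ n ⟩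
        n + e * ∑ (λ z → gain z p) ∎)
        where
        regroup : ∀ e n t → e * (n * t) ≡ t * e * n
        regroup = solve-∀
      -- One full `z` is needed to know the size of `S`. If all were short, then `e * n ≤ n`,
      -- against `e ≥ 2` and `n > 0`.
      some-full : ∃ λ z → gain z p ≡ suc t
      some-full = go (any? λ z → gain z p ≟ℕ suc t)
        where
        go : Dec (∃ λ z → gain z p ≡ suc t) → ∃ λ z → gain z p ≡ suc t
        go (yes found) = found
        go (no none) = contradiction (begin-strict
          n                                ≡⟨ *-identityˡ n ⟨
          1 * n                            <⟨ *-monoˡ-< n 2≤e ⟩
          e * n                            ≡⟨ cong (e *_) (trans (∑-const n 1) (*-identityʳ n)) ⟨
          e * ∑ {n} (λ z → 1)              ≤⟨ *-monoʳ-≤ e (∑-mono λ z → ≤-reflexive (sym (⟦⟧-yes (short? z) λ full → none (z , full)))) ⟩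
          e * # short?                     ≤⟨ few-short ⟩
          n ∎) (<-irrefl refl)
      covers : n ≤ ∣ ⟪ T? ⟫ ∣ + # short?
      covers = begin
        n                                        ≡⟨ trans (∑-const n 1) (*-identityʳ n) ⟨
        ∑ {n} (λ z → 1)                          ≤⟨ ∑-mono (λ z → go z (gain z p ≟ℕ suc t)) ⟩
        ∑ (λ z → ⟦ T? z ⟧ + ⟦ short? z ⟧)        ≡⟨ ∑-distrib-+ (λ z → ⟦ T? z ⟧) _ ⟩
        # T? + # short?                          ≡⟨ cong (_+ # short?) (∣⟪⟫∣ T?) ⟨
        ∣ ⟪ T? ⟫ ∣ + # short? ∎
        where
        go : ∀ z (f : Dec (gain z p ≡ suc t)) → 1 ≤ ⟦ T? z ⟧ + ⟦ ¬? f ⟧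
        go z (yes f) = m≤n⇒m≤n+o _ (≤-reflexive (sym (⟦⟧-yes (T? z) (proj₂ (full-gain z x y p′ f)))))
        go z (no f) = m≤n⇒m≤o+n _ (≤-reflexive (sym (⟦⟧-yes (¬? (no f)) f)))

    conclude : ∀ e → 2 ≤ e →
      e * (suc t * n ^ (3 + q)) ≤ e * ∑ᵛ (2 + q) (λ p → ∑ λ z → gain z p) + n ^ (3 + q) → Conclusion e
    conclude e 2≤e large =
      -- The `suc` makes the averaged inequality strict, as `∑ᵛ-compare` requires; it is stripped
      -- again from the result.
      let p , lt = ∑ᵛ-compare {n} (2 + q) (λ _ → suc t * e * n) (λ p → suc (e * ∑ (λ z → gain z p) + n)) average
      in extract e 2≤e p (s≤s⁻¹ lt)
      where
      open ≤-Reasoning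
      regroup : ∀ p t e n → p * (t * e * n) ≡ e * (t * (n * p))
      regroup = solve-∀
      average : ∑ᵛ {n} (2 + q) (λ _ → suc t * e * n) < ∑ᵛ (2 + q) (λ p → suc (e * ∑ (λ z → gain z p) + n))
      average = begin-strict
        ∑ᵛ {n} (2 + q) (λ _ → suc t * e * n)                                       ≡⟨ ∑ᵛ-const (2 + q) (suc t * e * n) ⟩
        n ^ (2 + q) * (suc t * e * n)                                              ≡⟨ regroup (n ^ (2 + q)) (suc t) e n ⟩
        e * (suc t * n ^ (3 + q))                                                  ≤⟨ large ⟩
        e * ∑ᵛ (2 + q) (λ p → ∑ λ z → gain z p) + n ^ (3 + q)                      <⟨ m<n+m _ (m^n>0 n (2 + q)) ⟩
        n ^ (2 + q) + (e * ∑ᵛ (2 + q) (λ p → ∑ λ z → gain z p) + n ^ (3 + q))      ≡⟨ cong₂ (λ u v → u + (v + n ^ (3 + q))) (sym (*-identityʳ (n ^ (2 + q)))) (*-∑ᵛ e (2 + q) (λ p → ∑ λ z → gain z p)) ⟩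
        n ^ (2 + q) * 1 + (∑ᵛ (2 + q) (λ p → e * ∑ λ z → gain z p) + n * n ^ (2 + q)) ≡⟨ cong (λ v → n ^ (2 + q) * 1 + (∑ᵛ (2 + q) (λ p → e * ∑ λ z → gain z p) + v)) (trans (*-comm n (n ^ (2 + q))) (sym (∑ᵛ-const (2 + q) n))) ⟩
        n ^ (2 + q) * 1 + (∑ᵛ (2 + q) (λ p → e * ∑ λ z → gain z p) + ∑ᵛ {n} (2 + q) (λ _ → n)) ≡⟨ cong₂ _+_ (sym (∑ᵛ-const (2 + q) 1)) (sym (∑ᵛ-distrib-+ (2 + q) (λ p → e * ∑ λ z → gain z p) (λ _ → n))) ⟩
        ∑ᵛ {n} (2 + q) (λ _ → 1) + ∑ᵛ (2 + q) (λ p → e * ∑ (λ z → gain z p) + n)   ≡⟨ ∑ᵛ-distrib-+ (2 + q) (λ _ → 1) (λ p → e * ∑ (λ z → gain z p) + n) ⟨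
        ∑ᵛ (2 + q) (λ p → suc (e * ∑ (λ z → gain z p) + n)) ∎

-- Powers, falling factorials and binomial coefficients.

P′≤^ : ∀ n k → n P′ k ≤ n ^ k
P′≤^ n zero = ≤-refl
P′≤^ n (suc k) = *-mono-≤ (m∸n≤m n k) (P′≤^ n k)

-- By induction: passing from `n` to `n ∸ suc k` in the next factor costs at most
-- `suc k * n ^ suc k`, and `(k + 1) + (k + 1)² ≤ (k + 2)²` absorbs this.
^≤P′ : ∀ n k → n ^ suc k ≤ n P′ suc k + suc k * suc k * n ^ k
^≤P′ n zero = m≤m+n (n * 1) 1
^≤P′ n (suc k) = begin
  n * n ^ suc k                                                          ≤⟨ *-monoʳ-≤ n (^≤P′ n k) ⟩
  n * (n P′ suc k + suc k * suc k * n ^ k)                               ≡⟨ *-distribˡ-+ n (n P′ suc k) _ ⟩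
  n * (n P′ suc k) + n * (suc k * suc k * n ^ k)                         ≤⟨ +-monoˡ-≤ _ (*-monoˡ-≤ (n P′ suc k) (≤-trans (m≤n+m∸n n (suc k)) (≤-reflexive (+-comm (suc k) (n ∸ suc k))))) ⟩
  (n ∸ suc k + suc k) * (n P′ suc k) + n * (suc k * suc k * n ^ k)       ≡⟨ cong₂ _+_ (*-distribʳ-+ (n P′ suc k) (n ∸ suc k) (suc k)) (swap n (suc k * suc k) (n ^ k)) ⟩
  n P′ suc (suc k) + suc k * (n P′ suc k) + suc k * suc k * n ^ suc k    ≤⟨ +-monoˡ-≤ _ (+-monoʳ-≤ (n P′ suc (suc k)) (*-monoʳ-≤ (suc k) (P′≤^ n (suc k)))) ⟩
  n P′ suc (suc k) + suc k * n ^ suc k + suc k * suc k * n ^ suc k       ≤⟨ m≤m+n _ ((2 + k) * n ^ suc k) ⟩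
  n P′ suc (suc k) + suc k * n ^ suc k + suc k * suc k * n ^ suc k + (2 + k) * n ^ suc k
                                                                         ≡⟨ collect (n P′ suc (suc k)) k (n ^ suc k) ⟩
  n P′ suc (suc k) + suc (suc k) * suc (suc k) * n ^ suc k ∎
  where
  open ≤-Reasoning
  swap : ∀ n c p → n * (c * p) ≡ c * (n * p)
  swap = solve-∀
  collect : ∀ f k p → f + suc k * p + suc k * suc k * p + (2 + k) * p ≡ f + suc (suc k) * suc (suc k) * p
  collect = solve-∀

k!*nCk : ∀ {n k} → k ≤ n → k ! * (n C k) ≡ n P′ k
k!*nCk {n} {k} k≤n = begin-equality
  k ! * (n C k)                 ≡⟨ cong (k ! *_) (nCk≡nPk/k! k≤n) ⟩
  k ! * ((n Perm k) / k !)       ≡⟨ cong (λ p → k ! * (p / k !)) (trans (nPk≡n!/[n∸k]! k≤n) (sym (nP′k≡n!/[n∸k]! k≤n))) ⟩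
  k ! * ((n P′ k) / k !)        ≡⟨ m*[n/m]≡n (k!∣nP′k k≤n) ⟩
  n P′ k ∎
  where
  open ≤-Reasoning
  instance
    _ = k !≢0

-- A diagonal choice of the error function.

module _ (N : ℕ → ℕ) where

  -- The largest index j ≤ b with N j ≤ n, or 0 if there is none.
  level : ℕ → ℕ → ℕ
  level n zero = zero
  level n (suc b) with N (suc b) ≤? n
  ... | yes _ = suc b
  ... | no _ = level n b

  level-sound : ∀ n b → N 0 ≤ n → N (level n b) ≤ n
  level-sound n zero N₀≤n = N₀≤n
  level-sound n (suc b) N₀≤n with N (suc b) ≤? n
  ... | yes N≤n = N≤n
  ... | no _ = level-sound n b N₀≤n

  level-max : ∀ n b j → j ≤ b → N j ≤ n → j ≤ level n b
  level-max n zero j j≤b _ = j≤b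
  level-max n (suc b) j j≤b N≤n with N (suc b) ≤? n
  ... | yes _ = j≤b
  ... | no N≰n with m≤n⇒m<n∨m≡n j≤b
  ...   | inj₁ j<b = level-max n b j (s≤s⁻¹ j<b) N≤n
  ...   | inj₂ refl = contradiction N≤n N≰n

  -- The divisor plays the role of `e`: it tends to infinity with `n`, and the summand 2 secures the
  -- `e ≥ 2` that `extract` requires.
  slow : ℕ → ℕ
  slow n = n / (2 + level n n)

  slow-littleO : LittleO slow (λ n → n)
  -- `e ≤ n` puts the index `e` into the range searched by `level n n`, and `N e ≤ n` makes it
  -- admissible.
  slow-littleO e = e ⊔ N e , λ n N≤n → begin
    e * slow n                ≤⟨ *-monoˡ-≤ (slow n) (m≤n⇒m≤o+n 2 (level-max n n e (m⊔n≤o⇒m≤o e (N e) N≤n) (m⊔n≤o⇒n≤o e (N e) N≤n))) ⟩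
    (2 + level n n) * slow n  ≡⟨ *-comm (2 + level n n) (slow n) ⟩
    slow n * (2 + level n n)  ≤⟨ m/n*n≤m n (2 + level n n) ⟩
    n ∎
    where open ≤-Reasoning

-- Choice of the parameters and the theorem.

-- For cycle length `ℓ = m + 1` the size `m / 2` of `S` is positive because `ℓ ≥ 3`; the two cases
-- are `ℓ = 2t + 3` and `ℓ = 2t + 4`.
half-parity : ∀ m → 2 ≤ m → ∃ λ t → m / 2 ≡ suc t × (m ≡ 2 + t * 2 ⊎ m ≡ 3 + t * 2)
half-parity m 2≤m with m / 2 in eq
... | zero = contradiction (≤-trans (m≥n⇒m/n>0 2≤m) (≤-reflexive eq)) λ ()
... | suc t = t , refl , go (m % 2) (m%n<n m 2) (trans (m≡m%n+[m/n]*n m 2) (cong (λ h → m % 2 + h * 2) eq))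
  where
  go : ∀ r → r < 2 → m ≡ r + suc t * 2 → m ≡ 2 + t * 2 ⊎ m ≡ 3 + t * 2
  go zero _ e = inj₁ e
  go (suc zero) _ e = inj₂ e
  go (suc (suc r)) (s≤s (s≤s ())) _

module _ (q t : ℕ) (e : ℕ) where

  -- Chosen so that `few-nonhub-tuples` leaves at most `n ^ (k - 1) / (3 * e)` tuples without a hub
  -- as center.
  degreeThreshold : ℕ
  degreeThreshold = 3 * e * (2 * linkBound t)

  -- The coefficient of `n ^ (k - 2)` in the error: poor vertices give the first summand, the
  -- comparison of `n ^ (k - 1)` with the falling factorial the second.
  lowerOrder : ℕ
  lowerOrder = hubBound t degreeThreshold * povertyBound t degreeThreshold + suc t * ((3 + q) * (3 + q))

  -- Ordered tuples are counted from below by the density of `𝓕` and from above by `total-gain`. The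
  -- three errors, namely lower order terms, non-hubs and `γ`, each take a third of the allowed
  -- `n ^ (k - 1) / e`.
  approximate : ∀ {n m} → 2 ≤ e → m ≡ 2 + t * 2 ⊎ m ≡ 3 + t * 2 → 1 ≤ n → 3 + q ≤ n → 3 * e * lowerOrder ≤ n →
    ∀ γ → 3 * e * (3 + q) ! * γ ≤ n ^ (3 + q) →
    (𝓕 : Family n) → Unique 𝓕 → (∀ F → F ∈ˡ 𝓕 → ∣ F ∣ ≡ 4 + q) →
    Centralized ((4 + q) * suc m) 𝓕 → ¬ ContainsCycle m 𝓕 →
    suc t * (n C (3 + q)) ≤ length 𝓕 + γ →
    Σ (Subset n) λ S → Σ (Subset n) λ T → ∃ λ r →
      (∀ x → x ∈ S → x ∉ T) × ∣ S ∣ ≡ suc t × n ≤ ∣ T ∣ + r × e * r ≤ n ×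
      (∀ a x → a ∈ S → x ∈ T → InKer ((4 + q) * suc m) 𝓕 (⁅ a ⁆ ∪ ⁅ x ⁆))
  approximate {n} {m} 2≤e parity 1≤n q<n low γ γ-small 𝓕 unique uniform centralized cycle-free dense =
    conclude e 2≤e (begin
      e * (suc t * n ^ (3 + q))                                         ≤⟨ *-monoʳ-≤ e main ⟩
      e * (Γ + lowerOrder * n ^ (2 + q) + nonhub-tuples + (3 + q) ! * γ)  ≡⟨ expand e Γ (lowerOrder * n ^ (2 + q)) nonhub-tuples ((3 + q) ! * γ) ⟩
      e * Γ + (e * (lowerOrder * n ^ (2 + q)) + e * nonhub-tuples + e * ((3 + q) ! * γ)) ≤⟨ +-monoʳ-≤ (e * Γ) (*-cancelˡ-≤ 3 errors) ⟩
      e * Γ + n ^ (3 + q) ∎)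
    where
    open ≤-Reasoning
    instance
      n≢0 : NonZero n
      n≢0 = >-nonZero 1≤n
    open CenteredFamily {t = t} {q} refl parity 𝓕 unique uniform centralized cycle-free
    open Threshold degreeThreshold
    Γ : ℕ
    Γ = ∑ᵛ (2 + q) (λ p → ∑ λ z → gain z p)
    expand : ∀ e g l n c → e * (g + l + n + c) ≡ e * g + (e * l + e * n + e * c)
    expand = solve-∀
    main : suc t * n ^ (3 + q) ≤ Γ + lowerOrder * n ^ (2 + q) + nonhub-tuples + (3 + q) ! * γ
    main = begin
      suc t * n ^ (3 + q)                                                                   ≤⟨ *-monoʳ-≤ (suc t) (^≤P′ n (2 + q)) ⟩
      suc t * (n P′ (3 + q) + (3 + q) * (3 + q) * n ^ (2 + q))                              ≡⟨ cong (λ f → suc t * (f + (3 + q) * (3 + q) * n ^ (2 + q))) (k!*nCk q<n) ⟨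
      suc t * ((3 + q) ! * (n C (3 + q)) + (3 + q) * (3 + q) * n ^ (2 + q))                 ≡⟨ arrange₁ (suc t) ((3 + q) !) (n C (3 + q)) ((3 + q) * (3 + q)) (n ^ (2 + q)) ⟩
      (3 + q) ! * (suc t * (n C (3 + q))) + suc t * ((3 + q) * (3 + q)) * n ^ (2 + q)       ≤⟨ +-monoˡ-≤ _ (*-monoʳ-≤ ((3 + q) !) dense) ⟩
      (3 + q) ! * (length 𝓕 + γ) + suc t * ((3 + q) * (3 + q)) * n ^ (2 + q)                ≡⟨ cong (_+ suc t * ((3 + q) * (3 + q)) * n ^ (2 + q)) (*-distribˡ-+ ((3 + q) !) (length 𝓕) γ) ⟩
      (3 + q) ! * length 𝓕 + (3 + q) ! * γ + suc t * ((3 + q) * (3 + q)) * n ^ (2 + q)      ≤⟨ +-monoˡ-≤ _ (+-monoˡ-≤ _ (≤-trans ordered-count total-gain)) ⟩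
      Γ + hub-bound * poverty-bound * n ^ (2 + q) + nonhub-tuples + (3 + q) ! * γ + suc t * ((3 + q) * (3 + q)) * n ^ (2 + q)
        ≡⟨ arrange₂ Γ (hub-bound * poverty-bound) (n ^ (2 + q)) nonhub-tuples ((3 + q) ! * γ) (suc t * ((3 + q) * (3 + q))) ⟩
      Γ + lowerOrder * n ^ (2 + q) + nonhub-tuples + (3 + q) ! * γ ∎
      where
      arrange₁ : ∀ t f c k p → t * (f * c + k * p) ≡ f * (t * c) + t * k * p
      arrange₁ = solve-∀
      arrange₂ : ∀ g h p n c s → g + h * p + n + c + s * p ≡ g + (h + s) * p + n + c
      arrange₂ = solve-∀
    errors : 3 * (e * (lowerOrder * n ^ (2 + q)) + e * nonhub-tuples + e * ((3 + q) ! * γ)) ≤ 3 * n ^ (3 + q)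
    errors = begin
      3 * (e * (lowerOrder * n ^ (2 + q)) + e * nonhub-tuples + e * ((3 + q) ! * γ))             ≡⟨ spread e lowerOrder (n ^ (2 + q)) nonhub-tuples ((3 + q) !) γ ⟩
      3 * e * lowerOrder * n ^ (2 + q) + 3 * e * nonhub-tuples + 3 * e * (3 + q) ! * γ           ≤⟨ +-mono-≤ (+-mono-≤ (*-monoˡ-≤ (n ^ (2 + q)) low) nonhub-small) γ-small ⟩
      n ^ (3 + q) + n ^ (3 + q) + n ^ (3 + q)                                                    ≡⟨ triple (n ^ (3 + q)) ⟩
      3 * n ^ (3 + q) ∎
      where
      spread : ∀ e l p n f c → 3 * (e * (l * p) + e * n + e * (f * c)) ≡ 3 * e * l * p + 3 * e * n + 3 * e * f * c
      spread = solve-∀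
      triple : ∀ x → x + x + x ≡ 3 * x
      triple = solve-∀
      nonhub-small : 3 * e * nonhub-tuples ≤ n ^ (3 + q)
      nonhub-small = *-cancelˡ-≤ (2 * linkBound t) (begin
        2 * linkBound t * (3 * e * nonhub-tuples)  ≡⟨ swap (2 * linkBound t) (3 * e) nonhub-tuples ⟩
        degreeThreshold * nonhub-tuples            ≤⟨ few-nonhub-tuples ⟩
        2 * linkBound t * n ^ (3 + q) ∎)
        where
        swap : ∀ c e n → c * (e * n) ≡ e * c * n
        swap = solve-∀

theorem9p1 : ∀ (k m : ℕ) → 4 ≤ k → 3 ≤ suc m →
    ∀ (g : ℕ → ℕ) → LittleO g (λ n → n ^ (k ∸ 1)) →
    ∃ λ (h : ℕ → ℕ) → LittleO h (λ n → n) ×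
    ∃ λ (n₁ : ℕ) → ∀ (n : ℕ) → n₁ ≤ n →
    ∀ (𝓕 : Family n) → Unique 𝓕 → All (λ A → ∣ A ∣ ≡ k) 𝓕 →
    Centralized (k * suc m) 𝓕 →
    ¬ ContainsCycle m 𝓕 →
    ((m / 2) * (n C (k ∸ 1)) ≤ length 𝓕 + g n) →
    Σ (Subset n) λ S → Σ (Subset n) λ T →
    (∀ x → x ∈ S → x ∉ T) ×
    ∣ S ∣ ≡ m / 2 ×
    n ≤ ∣ T ∣ + h n ×
    (∀ (a x : Fin n) → a ∈ S → x ∈ T → InKer (k * suc m) 𝓕 (⁅ a ⁆ ∪ ⁅ x ⁆))
theorem9p1 (suc (suc (suc (suc q)))) m (s≤s (s≤s (s≤s (s≤s z≤n)))) 3≤ℓ g g-small with half-parity m (s≤s⁻¹ 3≤ℓ)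
... | t , m/2≡ , parity rewrite m/2≡ = slow N , slow-littleO N , N 0 , result
  where
  low gap N : ℕ → ℕ
  low j = 3 * (2 + j) * lowerOrder q t (2 + j)
  gap j = proj₁ (g-small (3 * (2 + j) * (3 + q) !))
  -- From `N j` on, the demands of `approximate` with `e = 2 + j` and `γ = g n` are met; `gap j`
  -- comes from `g` being of smaller order than `n ^ (k - 1)`.
  N j = (3 + q) ⊔ (low j ⊔ gap j)
  result : ∀ n → N 0 ≤ n → (𝓕 : Family n) → Unique 𝓕 → All (λ A → ∣ A ∣ ≡ 4 + q) 𝓕 →
    Centralized ((4 + q) * suc m) 𝓕 → ¬ ContainsCycle m 𝓕 → suc t * (n C (3 + q)) ≤ length 𝓕 + g n →
    Σ (Subset n) λ S → Σ (Subset n) λ T →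
    (∀ x → x ∈ S → x ∉ T) × ∣ S ∣ ≡ suc t × n ≤ ∣ T ∣ + slow N n ×
    (∀ (a x : Fin n) → a ∈ S → x ∈ T → InKer ((4 + q) * suc m) 𝓕 (⁅ a ⁆ ∪ ⁅ x ⁆))
  result n N₀≤n 𝓕 unique uniform centralized cycle-free dense =
    let S , T , r , disjoint , sizeS , sizeT , r-small , kernel = approximate q t (2 + j) (s≤s (s≤s z≤n)) parity
          (≤-trans (s≤s z≤n) q<n) q<n
          (m⊔n≤o⇒m≤o (low j) (gap j) rest)
          (g n) (proj₂ (g-small (3 * (2 + j) * (3 + q) !)) n (m⊔n≤o⇒n≤o (low j) (gap j) rest))
          𝓕 unique (λ F → ListAll.lookup uniform) centralized cycle-free dense
    in S , T , disjoint , sizeS , ≤-trans sizeT (+-monoʳ-≤ ∣ T ∣ (r≤ r r-small)) , kernel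
    where
    j : ℕ
    -- With this index, `2 + j` is the divisor in `slow N n`, so `r ≤ n / (2 + j)` is the required
    -- bound.
    j = level N n n
    N≤n : N j ≤ n
    N≤n = level-sound N n n N₀≤n
    q<n : 3 + q ≤ n
    q<n = m⊔n≤o⇒m≤o (3 + q) (low j ⊔ gap j) N≤n
    rest : low j ⊔ gap j ≤ n
    rest = m⊔n≤o⇒n≤o (3 + q) (low j ⊔ gap j) N≤n
    r≤ : ∀ r → (2 + j) * r ≤ n → r ≤ slow N n
    r≤ r small = begin
      r                    ≡⟨ m*n/n≡m r (2 + j) ⟨
      r * (2 + j) / (2 + j) ≤⟨ /-monoˡ-≤ (2 + j) (≤-trans (≤-reflexive (*-comm r (2 + j))) small) ⟩
      n / (2 + j) ∎
      where open ≤-Reasoning
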